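{- Let $A=\{0,1\}$. There are exactly 13 distinct relationally defined permutation clones on $A$.
   Context: Let $A$ be a finite set. For $n\in\mathbb{N}$ let $B_n(A)=\mathrm{Sym}(A^n)$ and $B(A)=\bigcup_{n\in\mathbb{N}}B_n(A)$. For $\alpha\in S_n$ the wire permutation $\pi_\alpha\in B_n(A)$ is $(x_1,\dots,x_n)\mapsto(x_{\alpha^{ -1}(1)},\dots,x_{\alpha^{ -1}(n)})$; $i_n$ denotes the identity of $A^n$. For $f\in B_n(A)$, $g\in B_m(A)$, the parallel composition $f\oplus g\in B_{n+m}(A)$ applies $f$ to the first $n$ coordinates and $g$ to the last $m$ coordinates. Serial composition $f\bullet g$ is composition in $\mathrm{Sym}(A^n)$ when both have arity $n$; if the arities differ, the one of smaller arity $r$ is first replaced by its parallel composition with $i_{s-r}$, $s$ the larger arity. A permutation clone is a subset of $B(A)$ containing all wire permutations and closed under $\oplus$ and $\bullet$. For a relation $R\subseteq A^k$ and $f\in B_n(A)$, say $f$ respects $R$ if for every $k\times n$ array over $A$ whose columns all lie in $R$, the array obtained by applying $f$ to each row also has all columns in $R$. $\mathrm{PPol}(R)$ is the set of all $f\in B(A)$ respecting $R$ (equivalently, the polymorphisms of the weight $w_R:A^k\to(\{0,1\},\wedge)$, the characteristic function of $R$). A relationally defined permutation clone is a permutation clone of the form $\mathrm{PPol}(R)$ for some relation $R\subseteq A^k$, $k\ge 1$. -}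

module Defs where

open import Data.Nat using (ℕ)
open import Data.Bool using (Bool; true)
open import Data.Fin using (Fin)
open import Data.Vec using (Vec; map; lookup)
open import Function.Bundles using (_↔_; Inverse; _⇔_)
open import Relation.Binary.PropositionalEquality using (_≡_)
open import Level using (0ℓ)

B : ℕ → Set
B n = Vec Bool n ↔ Vec Bool n

Rel : ℕ → Set
Rel k = Vec Bool k → Bool

_∈R_ : ∀ {k} → Vec Bool k → Rel k → Set
x ∈R R = R x ≡ true

-- A k×n array over A is a vector of k rows, each in A^n.
-- Column j of the array M.
column : ∀ {k n} → Fin n → Vec (Vec Bool n) k → Vec Bool k
column j M = map (lookup' j) M
  where
  lookup' : ∀ {n} → Fin n → Vec Bool n → Bool
  lookup' j v = lookup v j

Respects : ∀ {n k} → (Vec Bool n → Vec Bool n) → Rel k → Set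
Respects {n} {k} f R =
  (M : Vec (Vec Bool n) k) →
  (∀ (j : Fin n) → column j M ∈R R) →
  (∀ (j : Fin n) → column j (map f M) ∈R R)

-- PPol(R) ⊆ B(A) = ⋃_n B_n(A): membership of (n , f) with f ∈ B_n(A).
PPol : ∀ {k} → Rel k → (n : ℕ) → B n → Set
PPol R n f = Respects (Inverse.to f) R

SamePPol : ∀ {k l} → Rel k → Rel l → Set
SamePPol R S = ∀ (n : ℕ) (f : B n) → PPol R n f ⇔ PPol S n f

{-# OPTIONS --safe #-}
module Submission where

-- A bijection respects R exactly when all its components lie in the clone C = Pol(R).
--
-- If x + y + z ∈ C, then C is determined by six test functions: either maj ∉ C, every member of C
-- is affine, and f(x,y,r) = f(x,x,r) + f(x,y,x,…,x) + f(x,…,x); or maj ∈ C, and C contains the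
-- switch "if x = y then a else b", by which f(x,y,z,r) is recovered from its minors identifying
-- two of x, y, z. In both cases f is generated by its binary minors.
--
-- If x + y + z ∉ C, every component of a bijection with components in C is a coordinate or its
-- negation. With ¬ ∈ C, every member of C has at most one sensitive coordinate at each point. Without
-- it, C consists of monotone functions, or of functions preserving disjointness (or dually), and
-- a bijection of the cube with such components is bounded by, hence equal to, a permutation of
-- coordinates.
--
-- The generation facts about ternary functions are checked over all 256 truth tables.

open import Defs
open import Data.Bool using (Bool; true; false; not; _∧_; _∨_; _xor_; if_then_else_)
open import Data.Bool.ListAction using (any)
open import Data.Bool.Properties using (not-involutive; ¬-not; ∧-zeroʳ; ∨-zeroʳ; xor-identityʳ; xor-same) renaming (_≟_ to _≟ᵇ_)
open import Data.Fin using (Fin; zero; suc; punchOut; _≟_)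
open import Data.Fin.Properties using (punchOut-injective; injective⇒≤; all?; any?; ¬∀⟶∃¬; suc-injective)
open import Data.List as List using (List; []; _∷_; _++_; concatMap)
open import Data.List.Relation.Unary.Any using (Any; here; there)
open import Data.Nat using (ℕ; zero; suc; _<_; _≤_; s≤s; z≤n)
open import Data.Nat.Induction using (<-wellFounded)
open import Data.Nat.Properties using (≤-refl; m≤n⇒m≤1+n; 1+n≰n)
open import Data.Product using (Σ; Σ-syntax; ∃-syntax; _×_; _,_; proj₁; proj₂)
open import Data.Sum as Sum using (_⊎_; inj₁; inj₂; fromInj₂)
open import Data.Vec using (Vec; []; _∷_; map; lookup; tabulate; replicate; updateAt; _[_]≔_)
open import Data.Vec.Properties using (≡-dec; map-∘; map-cong; map-id; lookup-map; lookup-replicate; tabulate-cong; tabulate∘lookup; lookup∘tabulate; lookup∘updateAt; lookup∘updateAt′)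
open import Data.Vec.Relation.Unary.All as All using (All; []; _∷_)
open import Data.Vec.Relation.Unary.All.Properties using (lookup⁺)
open import Function using (_∘_; case_of_)
open import Function.Bundles using (Inverse; Equivalence; mk⇔; mk↔ₛ′)
open import Function.Definitions using (Injective)
open import Induction.WellFounded using (Acc; acc)
open import Relation.Binary.PropositionalEquality
open import Relation.Nullary using (¬_; Dec; yes; no; contradiction)
open import Relation.Nullary.Decidable using (decidable-stable; from-yes; map′; _⊎-dec_)

private variable
  k l m n : ℕ

-- Components of bijections and the clone of polymorphisms

Fn : ℕ → Set
Fn n = Vec Bool n → Bool

-- A record rather than a function, so that R and g can be inferred from the type.
record Pol (R : Rel k) (g : Fn n) : Set where
  constructor pol
  field
    preserves : ∀ M → (∀ j → column j M ∈R R) → map g M ∈R R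

open Pol

component : B n → Fin n → Fn n
component f j v = lookup (Inverse.to f v) j

module _ {R : Rel k} where

  PPol⇒Pol : (f : B n) → PPol R n f → ∀ j → Pol R (component f j)
  PPol⇒Pol f p j .preserves M c =
    trans (cong R (map-∘ (λ v → lookup v j) (Inverse.to f) M)) (p M c j)

  Pol⇒PPol : (f : B n) → (∀ j → Pol R (component f j)) → PPol R n f
  Pol⇒PPol f p M c j =
    trans (cong R (sym (map-∘ (λ v → lookup v j) (Inverse.to f) M))) (p j .preserves M c)

  Pol-ext : {g h : Fn n} → g ≗ h → Pol R g → Pol R h
  Pol-ext g≗h p .preserves M c = trans (cong R (sym (map-cong g≗h M))) (p .preserves M c)

  Pol-proj : (i : Fin n) → Pol R (λ v → lookup v i)
  Pol-proj i .preserves M c = c i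

  Pol-comp : {g : Fn m} → Pol R g → (h : Fin m → Fn n) → (∀ i → Pol R (h i)) →
             Pol R (λ v → g (tabulate (λ i → h i v)))
  Pol-comp {g = g} p h q .preserves M c =
    trans (cong R (map-∘ g (λ v → tabulate (λ i → h i v)) M))
          (p .preserves (map (λ v → tabulate (λ i → h i v)) M) λ j →
            trans (cong R (trans (sym (map-∘ (λ v → lookup v j) _ M))
                                 (map-cong (λ v → lookup∘tabulate (λ i → h i v) j) M)))
                  (q j .preserves M c))

  Pol-minor : {g : Fn m} → Pol R g → (σ : Fin m → Fin n) →
              Pol R (λ v → g (tabulate (λ i → lookup v (σ i))))
  Pol-minor p σ = Pol-comp p (λ i v → lookup v (σ i)) (λ i → Pol-proj (σ i))

tabulate-≡ : {A : Set} (f : Fin n → A) (v : Vec A n) → (∀ i → f i ≡ lookup v i) → tabulate f ≡ v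
tabulate-≡ f v e = trans (tabulate-cong e) (tabulate∘lookup v)

-- Ternary Boolean functions as truth tables

Table : Set
Table = Vec Bool 8

fun : Table → Bool → Bool → Bool → Bool
fun (a ∷ _) false false false = a
fun (_ ∷ a ∷ _) false false true = a
fun (_ ∷ _ ∷ a ∷ _) false true false = a
fun (_ ∷ _ ∷ _ ∷ a ∷ _) false true true = a
fun (_ ∷ _ ∷ _ ∷ _ ∷ a ∷ _) true false false = a
fun (_ ∷ _ ∷ _ ∷ _ ∷ _ ∷ a ∷ _) true false true = a
fun (_ ∷ _ ∷ _ ∷ _ ∷ _ ∷ _ ∷ a ∷ _) true true false = a
fun (_ ∷ _ ∷ _ ∷ _ ∷ _ ∷ _ ∷ _ ∷ a ∷ _) true true true = a

⟦_⟧ : Table → Fn 3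
⟦ t ⟧ (x ∷ y ∷ z ∷ []) = fun t x y z

table : (Bool → Bool → Bool → Bool) → Table
table f = f false false false ∷ f false false true ∷ f false true false ∷ f false true true
        ∷ f true false false ∷ f true false true ∷ f true true false ∷ f true true true ∷ []

fun-table : ∀ f x y z → fun (table f) x y z ≡ f x y z
fun-table f false false false = refl
fun-table f false false true  = refl
fun-table f false true  false = refl
fun-table f false true  true  = refl
fun-table f true  false false = refl
fun-table f true  false true  = refl
fun-table f true  true  false = refl
fun-table f true  true  true  = refl

curry₃ : Fn 3 → Bool → Bool → Bool → Bool
curry₃ g x y z = g (x ∷ y ∷ z ∷ [])

module _ {R : Rel k} where

  Pol-table : {g : Fn 3} → Pol R g → Pol R ⟦ table (curry₃ g) ⟧
  Pol-table {g = g} = Pol-ext λ { (x ∷ y ∷ z ∷ []) → sym (fun-table (curry₃ g) x y z) }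

  Pol-app : (t : Table) → Pol R ⟦ t ⟧ → {a b c : Fn n} → Pol R a → Pol R b → Pol R c →
            Pol R (λ v → fun t (a v) (b v) (c v))
  Pol-app t p {a} {b} {c} pa pb pc = Pol-comp p h ph
    where
    h : Fin 3 → Fn _
    h zero             = a
    h (suc zero)       = b
    h (suc (suc zero)) = c
    ph : ∀ i → Pol R (h i)
    ph zero             = pa
    ph (suc zero)       = pb
    ph (suc (suc zero)) = pc

-- Terms over ternary functions and exhaustive checks by evaluation

data Term (m : ℕ) : Set where
  𝕩 𝕪 𝕫 : Term m
  app   : Fin m → Term m → Term m → Term m → Term m

infix 4 _==_

_==_ : Vec Bool n → Vec Bool n → Bool
[] == [] = true
(a ∷ v) == (b ∷ w) = if a xor b then false else v == w

==⇒≡ : (v w : Vec Bool n) → (v == w) ≡ true → v ≡ w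
==⇒≡ [] [] _ = refl
==⇒≡ (false ∷ v) (false ∷ w) e = cong (false ∷_) (==⇒≡ v w e)
==⇒≡ (true ∷ v) (true ∷ w) e = cong (true ∷_) (==⇒≡ v w e)

infixr 3 _⇒_

-- Lazy in its second argument: in an exhaustive check the costly conclusion is evaluated only where
-- the premise holds.
_⇒_ : Bool → Bool → Bool
false ⇒ _ = true
true  ⇒ b = b

⇒-elim : ∀ {a b} → (a ⇒ b) ≡ true → a ≡ true → b ≡ true
⇒-elim e refl = e

every : ∀ n → (Vec Bool n → Bool) → Bool
every zero    p = p []
every (suc n) p = every n (p ∘ (false ∷_)) ∧ every n (p ∘ (true ∷_))

∧-true : ∀ {a b} → a ∧ b ≡ true → a ≡ true × b ≡ true
∧-true {true} e = refl , e

every-sound : (p : Vec Bool n → Bool) → every n p ≡ true → ∀ v → p v ≡ true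
every-sound p e []          = e
every-sound p e (false ∷ v) = every-sound _ (proj₁ (∧-true e)) v
every-sound p e (true ∷ v)  = every-sound _ (proj₂ (∧-true {a = every _ (p ∘ (false ∷_))} e)) v

every-complete : (p : Vec Bool n → Bool) → (∀ v → p v ≡ true) → every n p ≡ true
every-complete {zero}  p e = e []
every-complete {suc n} p e =
  cong₂ _∧_ (every-complete _ (e ∘ (false ∷_))) (every-complete _ (e ∘ (true ∷_)))

eval : Vec Table m → Term m → Table
eval G 𝕩 = table λ x y z → x
eval G 𝕪 = table λ x y z → y
eval G 𝕫 = table λ x y z → z
eval G (app i a b c) = ap (lookup G i) (eval G a) (eval G b) (eval G c)
  where
  ap : Table → Table → Table → Table → Table
  ap g a b c = table λ x y z → fun g (fun a x y z) (fun b x y z) (fun c x y z)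

-- Which term reaches the target varies with the generators, so a fixed list of candidates is tried.
derives : Vec Table m → List (Term m) → (Table → Bool) → Bool
derives G ts target = any (target ∘ eval G) ts

oneOf : List Table → Table → Bool
oneOf ts t = any (t ==_) ts

module _ {R : Rel k} where

  eval-sound : {G : Vec Table m} → All (Pol R ∘ ⟦_⟧) G → (t : Term m) → Pol R ⟦ eval G t ⟧
  eval-sound p 𝕩 = Pol-table (Pol-proj zero)
  eval-sound p 𝕪 = Pol-table (Pol-proj (suc zero))
  eval-sound p 𝕫 = Pol-table (Pol-proj (suc (suc zero)))
  eval-sound {G = G} p (app i a b c) =
    Pol-table (Pol-app (lookup G i) (lookup⁺ p i)
      (eval-sound p a) (eval-sound p b) (eval-sound p c))

  derives-sound : {G : Vec Table m} → All (Pol R ∘ ⟦_⟧) G → ∀ ts target →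
                  derives G ts target ≡ true → ∃[ t ] target t ≡ true × Pol R ⟦ t ⟧
  derives-sound {G = G} p (t ∷ ts) target e with target (eval G t) in eq
  ... | true  = eval G t , eq , eval-sound p t
  ... | false = derives-sound p ts target e

-- Functions of fewer than three arguments ignore the trailing ones, so that all generators are
-- ternary.
ID ZERO ONE NOT AND OR XOR IFF LT LE XOR₃ MAJ DISC : Table
ID   = table λ a b c → a
ZERO = table λ a b c → false
ONE  = table λ a b c → true
NOT  = table λ a b c → not a
AND  = table λ a b c → a ∧ b
OR   = table λ a b c → a ∨ b
XOR  = table λ a b c → a xor b
IFF  = table λ a b c → not (a xor b)
LT   = table λ a b c → not a ∧ b
LE   = table λ a b c → not a ∨ b
XOR₃ = table λ a b c → a xor (b xor c)
MAJ  = table λ a b c → (a ∧ b) ∨ (c ∧ (a ∨ b))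
DISC = table λ a b c → if a xor b then a else c

-- Generation facts for ternary functions

TermOp : ℕ → Set
TermOp m = Term m → Term m → Term m → Term m

g₀ : TermOp (suc m)
g₀ = app zero

g₁ : TermOp (suc (suc m))
g₁ = app (suc zero)

g₂ : TermOp (suc (suc (suc m)))
g₂ = app (suc (suc zero))

module _ {R : Rel k} where

  pick : ∀ us t → oneOf us t ≡ true → Pol R ⟦ t ⟧ → Any (Pol R ∘ ⟦_⟧) us
  pick (u ∷ us) t e p with t == u in eq
  ... | true  = here (subst (Pol R ∘ ⟦_⟧) (==⇒≡ t u eq) p)
  ... | false = there (pick us t e p)

  generate : {G : Vec Table m} (t : Term m) (u : Table) → eval G t ≡ u →
             All (Pol R ∘ ⟦_⟧) G → Pol R ⟦ u ⟧
  generate t u refl p = eval-sound p t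

  -- The Boolean premise is evaluated at all 256 tables. Since `t` is put in front of `G`, in `ts`
  -- the symbol `g₀` stands for `t`, and `g₁`, `g₂` stand for the entries of `G`.
  generate∀ : (cond : Table → Bool) (G : Vec Table m) (ts : List (Term (suc m))) (us : List Table) →
              every 8 (λ t → cond t ⇒ derives (t ∷ G) ts (oneOf us)) ≡ true →
              ∀ t → cond t ≡ true → Pol R ⟦ t ⟧ → All (Pol R ∘ ⟦_⟧) G → Any (Pol R ∘ ⟦_⟧) us
  generate∀ cond G ts us e t ct p ps
    with derives-sound (p ∷ ps) ts (oneOf us) (⇒-elim (every-sound
           (λ t → cond t ⇒ derives (t ∷ G) ts (oneOf us)) e t) ct)
  ... | u , e′ , q = pick us u e′ q

  XOR⇒XOR₃ : Pol R ⟦ XOR ⟧ → Pol R ⟦ XOR₃ ⟧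
  XOR⇒XOR₃ p = generate (g₀ 𝕩 (g₀ 𝕪 𝕫 𝕫) 𝕩) XOR₃ refl (p ∷ [])

  -- The two negations introduced by nesting `IFF` cancel.
  IFF⇒XOR₃ : Pol R ⟦ IFF ⟧ → Pol R ⟦ XOR₃ ⟧
  IFF⇒XOR₃ p = generate (g₀ 𝕩 (g₀ 𝕪 𝕫 𝕫) 𝕩) XOR₃ refl (p ∷ [])

  -- Two bits differ when one of them is strictly below the other.
  LT-OR⇒XOR₃ : Pol R ⟦ LT ⟧ → Pol R ⟦ OR ⟧ → Pol R ⟦ XOR₃ ⟧
  LT-OR⇒XOR₃ p q = XOR⇒XOR₃ (generate (g₁ (g₀ 𝕩 𝕪 𝕩) (g₀ 𝕪 𝕩 𝕩) 𝕩) XOR refl (p ∷ q ∷ []))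

  LE-AND⇒XOR₃ : Pol R ⟦ LE ⟧ → Pol R ⟦ AND ⟧ → Pol R ⟦ XOR₃ ⟧
  LE-AND⇒XOR₃ p q = IFF⇒XOR₃ (generate (g₁ (g₀ 𝕩 𝕪 𝕩) (g₀ 𝕪 𝕩 𝕩) 𝕩) IFF refl (p ∷ q ∷ []))

  -- The implication is ¬(a ∧ ¬b), and both implications together give `IFF`.
  AND-NOT⇒XOR₃ : Pol R ⟦ AND ⟧ → Pol R ⟦ NOT ⟧ → Pol R ⟦ XOR₃ ⟧
  AND-NOT⇒XOR₃ p q = IFF⇒XOR₃ (generate (g₀ (le 𝕩 𝕪) (le 𝕪 𝕩) 𝕩) IFF refl (p ∷ q ∷ []))
    where
    le : Term 2 → Term 2 → Term 2
    le a b = g₁ (g₀ a (g₁ b b b) a) a a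

  -- The sum output of a full adder, its carry being the majority.
  MAJ-NOT⇒XOR₃ : Pol R ⟦ MAJ ⟧ → Pol R ⟦ NOT ⟧ → Pol R ⟦ XOR₃ ⟧
  MAJ-NOT⇒XOR₃ p q =
    generate (g₀ (g₁ (g₀ 𝕩 𝕪 𝕫) 𝕩 𝕩) (g₀ 𝕩 𝕪 (g₁ 𝕫 𝕩 𝕩)) 𝕫) XOR₃ refl (p ∷ q ∷ [])

  -- `DISC` is the ternary discriminator. In maj(x, z, x + y + z) the last argument is z if x = y,
  -- and ¬z otherwise, which leaves the vote to x.
  MAJ-XOR₃⇒DISC : Pol R ⟦ MAJ ⟧ → Pol R ⟦ XOR₃ ⟧ → Pol R ⟦ DISC ⟧
  MAJ-XOR₃⇒DISC p q = generate (g₀ 𝕩 𝕫 (g₁ 𝕩 𝕪 𝕫)) DISC refl (p ∷ q ∷ [])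

-- Each fixes one pair of points at which a property fails. Two vectors that are ordered, disjoint
-- or codisjoint show only three patterns across their coordinates, so a violation in any arity has
-- a ternary minor of this shape.
nonmonotone nondisjoint noncodisjoint : Table → Bool
nonmonotone t   = fun t false false true ∧ not (fun t false true true)
nondisjoint t   = fun t false true false ∧ fun t false false true
noncodisjoint t = not (fun t true false true ∨ fun t true true false)

module _ {R : Rel k} (¬neg : ¬ Pol R ⟦ NOT ⟧) (¬xor₃ : ¬ Pol R ⟦ XOR₃ ⟧)
         (t : Table) (nm : nonmonotone t ≡ true) (p : Pol R ⟦ t ⟧) where

  -- By the choice of the two points, t(0, x, 1) is ¬x.
  nonmonotone-0-1 : Pol R ⟦ ZERO ⟧ → ¬ Pol R ⟦ ONE ⟧
  nonmonotone-0-1 p₀ p₁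
    with generate∀ nonmonotone (ZERO ∷ ONE ∷ []) (g₀ (g₁ 𝕩 𝕩 𝕩) 𝕩 (g₂ 𝕩 𝕩 𝕩) ∷ [])
                   (NOT ∷ []) refl t nm p (p₀ ∷ p₁ ∷ [])
  ... | here q = ¬neg q

  -- The function t(0, x, x ∨ y) is fixed except at x = y = 0, which leaves ¬x and ¬x ∧ y.
  nonmonotone-0-∨ : Pol R ⟦ ZERO ⟧ → ¬ Pol R ⟦ OR ⟧
  nonmonotone-0-∨ p₀ p∨
    with generate∀ nonmonotone (ZERO ∷ OR ∷ []) (g₀ (g₁ 𝕩 𝕩 𝕩) 𝕩 (g₂ 𝕩 𝕪 𝕪) ∷ [])
                   (NOT ∷ LT ∷ []) refl t nm p (p₀ ∷ p∨ ∷ [])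
  ... | here q         = ¬neg q
  ... | there (here q) = ¬xor₃ (LT-OR⇒XOR₃ q p∨)

  -- Dually, t(x ∧ y, x, 1) is fixed except at x = y = 1, which leaves ¬x and ¬x ∨ y.
  nonmonotone-∧-1 : Pol R ⟦ AND ⟧ → ¬ Pol R ⟦ ONE ⟧
  nonmonotone-∧-1 p∧ p₁
    with generate∀ nonmonotone (AND ∷ ONE ∷ []) (g₀ (g₁ 𝕩 𝕪 𝕪) 𝕩 (g₂ 𝕩 𝕩 𝕩) ∷ [])
                   (NOT ∷ LE ∷ []) refl t nm p (p∧ ∷ p₁ ∷ [])
  ... | here q         = ¬neg q
  ... | there (here q) = ¬xor₃ (LE-AND⇒XOR₃ q p∧)

  -- Composing t with the chain x ∧ y ∧ z ≤ maj x y z ≤ x ∨ y ∨ z yields a symmetric function,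
  -- which alternates along the chain and hence is the parity as soon as t is idempotent.
  nonmonotone-∧-∨ : Pol R ⟦ AND ⟧ → ¬ Pol R ⟦ OR ⟧
  nonmonotone-∧-∨ p∧ p∨
    with generate∀ nonmonotone (AND ∷ OR ∷ [])
                   (g₀ 𝕩 𝕩 𝕩 ∷
                    g₀ (g₁ 𝕩 (g₁ 𝕪 𝕫 𝕫) 𝕩) (g₂ (g₁ 𝕩 𝕪 𝕪) (g₁ 𝕫 (g₂ 𝕩 𝕪 𝕪) 𝕩) 𝕩)
                       (g₂ 𝕩 (g₂ 𝕪 𝕫 𝕫) 𝕩) ∷ [])
                   (ZERO ∷ ONE ∷ NOT ∷ XOR₃ ∷ []) refl t nm p (p∧ ∷ p∨ ∷ [])
  ... | here q                         = nonmonotone-0-∨ q p∨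
  ... | there (here q)                 = nonmonotone-∧-1 p∧ q
  ... | there (there (here q))         = ¬neg q
  ... | there (there (there (here q))) = ¬xor₃ q

  -- A diagonal other than the identity is a constant or ¬. If t is idempotent and no binary minor
  -- is ∧ or ∨, then t is x + y + z or the discriminator, and the last term turns the discriminator
  -- into x + y + z.
  nonmonotone⇒extremum : Any (Pol R ∘ ⟦_⟧) (ZERO ∷ ONE ∷ AND ∷ OR ∷ [])
  nonmonotone⇒extremum
    with generate∀ nonmonotone []
                   (g₀ 𝕩 𝕩 𝕩 ∷ g₀ 𝕩 𝕩 𝕪 ∷ g₀ 𝕩 𝕪 𝕩 ∷ g₀ 𝕩 𝕪 𝕪 ∷ g₀ 𝕩 𝕪 𝕫 ∷
                    g₀ (g₀ 𝕩 𝕪 𝕫) 𝕩 (g₀ 𝕩 𝕫 𝕪) ∷ [])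
                   (NOT ∷ XOR₃ ∷ ZERO ∷ ONE ∷ AND ∷ OR ∷ []) refl t nm p []
  ... | here q            = contradiction q ¬neg
  ... | there (here q)    = contradiction q ¬xor₃
  ... | there (there any) = any

module _ {R : Rel k} (¬neg : ¬ Pol R ⟦ NOT ⟧) (¬xor₃ : ¬ Pol R ⟦ XOR₃ ⟧)
         (t : Table) (p : Pol R ⟦ t ⟧) where

  -- With 0 or x ∧ y as first argument, t(_, x, y) is 1 whenever x ≠ y. If t(0,0,0) = 0 this is x +
  -- y or x ∨ y; otherwise the diagonal of t is 1 or ¬.
  nondisjoint⇒top : nondisjoint t ≡ true →
                    Pol R ⟦ ZERO ⟧ ⊎ Pol R ⟦ AND ⟧ → Pol R ⟦ ONE ⟧ ⊎ Pol R ⟦ OR ⟧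
  nondisjoint⇒top nd bottom = conclude (derived bottom)
    where
    derived : Pol R ⟦ ZERO ⟧ ⊎ Pol R ⟦ AND ⟧ → Any (Pol R ∘ ⟦_⟧) (NOT ∷ XOR ∷ ONE ∷ OR ∷ [])
    derived (inj₁ p₀) = generate∀ nondisjoint (ZERO ∷ []) (g₀ 𝕩 𝕩 𝕩 ∷ g₀ (g₁ 𝕩 𝕪 𝕪) 𝕩 𝕪 ∷ [])
      (NOT ∷ XOR ∷ ONE ∷ OR ∷ []) refl t nd p (p₀ ∷ [])
    derived (inj₂ p∧) = generate∀ nondisjoint (AND ∷ []) (g₀ 𝕩 𝕩 𝕩 ∷ g₀ (g₁ 𝕩 𝕪 𝕪) 𝕩 𝕪 ∷ [])
      (NOT ∷ XOR ∷ ONE ∷ OR ∷ []) refl t nd p (p∧ ∷ [])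
    conclude : Any (Pol R ∘ ⟦_⟧) (NOT ∷ XOR ∷ ONE ∷ OR ∷ []) → Pol R ⟦ ONE ⟧ ⊎ Pol R ⟦ OR ⟧
    conclude (here q)                         = contradiction q ¬neg
    conclude (there (here q))                 = contradiction (XOR⇒XOR₃ q) ¬xor₃
    conclude (there (there (here q)))         = inj₁ q
    conclude (there (there (there (here q)))) = inj₂ q

  -- The dual argument, with `IFF` in the role of `XOR`.
  noncodisjoint⇒bottom : noncodisjoint t ≡ true →
                         Pol R ⟦ ONE ⟧ ⊎ Pol R ⟦ OR ⟧ → Pol R ⟦ ZERO ⟧ ⊎ Pol R ⟦ AND ⟧
  noncodisjoint⇒bottom nd top = conclude (derived top)
    where
    derived : Pol R ⟦ ONE ⟧ ⊎ Pol R ⟦ OR ⟧ → Any (Pol R ∘ ⟦_⟧) (NOT ∷ IFF ∷ ZERO ∷ AND ∷ [])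
    derived (inj₁ p₁) = generate∀ noncodisjoint (ONE ∷ []) (g₀ 𝕩 𝕩 𝕩 ∷ g₀ (g₁ 𝕩 𝕪 𝕪) 𝕩 𝕪 ∷ [])
      (NOT ∷ IFF ∷ ZERO ∷ AND ∷ []) refl t nd p (p₁ ∷ [])
    derived (inj₂ p∨) = generate∀ noncodisjoint (OR ∷ []) (g₀ 𝕩 𝕩 𝕩 ∷ g₀ (g₁ 𝕩 𝕪 𝕪) 𝕩 𝕪 ∷ [])
      (NOT ∷ IFF ∷ ZERO ∷ AND ∷ []) refl t nd p (p∨ ∷ [])
    conclude : Any (Pol R ∘ ⟦_⟧) (NOT ∷ IFF ∷ ZERO ∷ AND ∷ []) → Pol R ⟦ ZERO ⟧ ⊎ Pol R ⟦ AND ⟧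
    conclude (here q)                         = contradiction q ¬neg
    conclude (there (here q))                 = contradiction (IFF⇒XOR₃ q) ¬xor₃
    conclude (there (there (here q)))         = inj₁ q
    conclude (there (there (there (here q)))) = inj₂ q

-- The second and third variables are both sensitive at the origin; the first one is there to absorb
-- all other coordinates.
twoSensitive : Table → Bool
twoSensitive t = (fun t false false false xor fun t false true false)
               ∧ (fun t false false false xor fun t false false true)

signedMinors : List (Term 2)
signedMinors = signed 𝕩 𝕪 𝕫 ++ signed 𝕩 𝕩 𝕪 ++ signed 𝕩 𝕪 𝕩 ++ signed 𝕩 𝕪 𝕪
  where
  signs : List (Term 2 → Term 2)
  signs = (λ a → a) ∷ (λ a → g₁ a a a) ∷ []
  signed : Term 2 → Term 2 → Term 2 → List (Term 2)
  signed a b c =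
    concatMap (λ s → concatMap (λ s₁ → concatMap (λ s₂ → List.map (λ s₃ →
      s (g₀ (s₁ a) (s₂ b) (s₃ c))) signs) signs) signs) signs

-- Identifying variables and negating inputs or output reduces every such table to one of four
-- functions, each of which yields x + y + z with the help of ¬.
twoSensitive⇒XOR₃ : {R : Rel k} (t : Table) → twoSensitive t ≡ true → Pol R ⟦ t ⟧ →
                    Pol R ⟦ NOT ⟧ → Pol R ⟦ XOR₃ ⟧
twoSensitive⇒XOR₃ t ts p p¬
  with generate∀ twoSensitive (NOT ∷ []) signedMinors (AND ∷ XOR ∷ MAJ ∷ XOR₃ ∷ [])
                 refl t ts p (p¬ ∷ [])
... | here q                         = AND-NOT⇒XOR₃ q p¬
... | there (here q)                 = XOR⇒XOR₃ q
... | there (there (here q))         = MAJ-NOT⇒XOR₃ q p¬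
... | there (there (there (here q))) = q

-- The sum of t over the four points with first coordinate a, which vanishes exactly when t is
-- affine on that face.
faceParity : Table → Bool → Bool
faceParity t a =
  fun t a (not a) (not a) xor (fun t a a (not a) xor (fun t a (not a) a xor fun t a a a))

-- A binary nonaffine function g yields g(x,y) + g(x,z) + g(y,z), which is maj + affine, and
-- a nonaffine ternary function without nonaffine binary minors is also of that form.
-- The affine part is cancelled by sums with variables and with the diagonal.
majTerms : List (Term 2)
majTerms = concatMap cancel
  (g₀ ∷ symmetrise (λ a b → g₀ a a b) ∷ symmetrise (λ a b → g₀ a b a) ∷
   symmetrise (λ a b → g₀ a b b) ∷ [])
  where
  symmetrise : (Term 2 → Term 2 → Term 2) → TermOp 2
  symmetrise g a b c = g₁ (g a b) (g a c) (g b c)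
  cancel : TermOp 2 → List (Term 2)
  cancel h = s 𝕩 𝕩 ∷ s 𝕪 𝕪 ∷ s 𝕫 𝕫 ∷ s 𝕩 𝕪 ∷ s 𝕪 𝕫 ∷ s 𝕩 𝕫 ∷ g₁ (s 𝕩 𝕩) 𝕪 𝕫 ∷ []
    where
    s : Term 2 → Term 2 → Term 2
    s p q = g₁ (h 𝕩 𝕪 𝕫) p (h q q q)

nonaffine⇒MAJ : {R : Rel k} (t : Table) → faceParity t false ∨ faceParity t true ≡ true →
                Pol R ⟦ t ⟧ → Pol R ⟦ XOR₃ ⟧ → Pol R ⟦ MAJ ⟧
nonaffine⇒MAJ t odd p px
  with generate∀ (λ t → faceParity t false ∨ faceParity t true) (XOR₃ ∷ []) majTerms (MAJ ∷ [])
                 refl t odd p (px ∷ [])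
... | here q = q

ignoresLast : Table → Fn 3
ignoresLast t (a ∷ b ∷ c ∷ []) = not (fun t a b c xor fun t a b false)

binary : Table → Bool
binary t = every 3 (ignoresLast t)

-- Besides the diagonal, the sums t(x,y) + p + t(q,q) for variables p and q, in which the affine
-- part of a binary t can cancel.
extractors : List (Term 2)
extractors = g₀ 𝕩 𝕩 𝕩 ∷ s 𝕩 𝕩 ∷ s 𝕩 𝕪 ∷ s 𝕪 𝕩 ∷ s 𝕪 𝕪 ∷ []
  where
  s : Term 2 → Term 2 → Term 2
  s p q = g₁ (g₀ 𝕩 𝕪 𝕪) p (g₀ q q q)

extract : Table → Table → Bool
extract t b = derives (t ∷ XOR₃ ∷ []) extractors (_== b)

-- A projection, present in every clone, stands in for what cannot be extracted, so the generators
-- keep fixed positions.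
extracted : Table → Table → Table
extracted t b = if extract t b then b else ID

-- The generators are x + y + z and the slots for 0, 1, ¬, ∧, in this order. A candidate that uses
-- an unfilled slot is accepted only if it still evaluates to the target.
rebuild : List (Term 5)
rebuild = 𝕩 ∷ 𝕪 ∷ zro ∷ one ∷ neg 𝕩 ∷ neg 𝕪 ∷ xor₃ 𝕩 𝕪 zro ∷ xor₃ 𝕩 𝕪 one ∷
          and ∷ or ∷ neg and ∷ neg or ∷
          xor₃ 𝕩 and zro ∷ xor₃ 𝕪 and zro ∷ xor₃ 𝕩 and one ∷ xor₃ 𝕪 and one ∷ []
  where
  xor₃ : TermOp 5
  xor₃ = g₀
  zro one and or : Term 5
  zro = app (suc zero) 𝕩 𝕩 𝕩
  one = app (suc (suc zero)) 𝕩 𝕩 𝕩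
  and = app (suc (suc (suc (suc zero)))) 𝕩 𝕪 𝕩
  or  = xor₃ 𝕩 𝕪 and
  neg : Term 5 → Term 5
  neg a = app (suc (suc (suc zero))) a a a

module _ {R : Rel k} {S : Rel l} (pR : Pol R ⟦ XOR₃ ⟧) (pS : Pol S ⟦ XOR₃ ⟧)
         (t0 : Pol R ⟦ ZERO ⟧ → Pol S ⟦ ZERO ⟧) (t1 : Pol R ⟦ ONE ⟧ → Pol S ⟦ ONE ⟧)
         (t¬ : Pol R ⟦ NOT ⟧ → Pol S ⟦ NOT ⟧) (t∧ : Pol R ⟦ AND ⟧ → Pol S ⟦ AND ⟧) where

  -- What t and x + y + z produce among 0, 1, ¬, ∧ lies in Pol R, hence by hypothesis in Pol S, and
  -- suffices to build t again there.
  transfer-binary : ∀ t → binary t ≡ true → Pol R ⟦ t ⟧ → Pol S ⟦ t ⟧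
  transfer-binary t bt p
    with derives-sound (pS ∷ carry ZERO t0 ∷ carry ONE t1 ∷ carry NOT t¬ ∷ carry AND t∧ ∷ [])
           rebuild (_== t) (⇒-elim (every-sound
             (λ t → binary t ⇒ derives (XOR₃ ∷ extracted t ZERO ∷ extracted t ONE ∷
                                        extracted t NOT ∷ extracted t AND ∷ []) rebuild (_== t))
             refl t) bt)
    where
    carry : ∀ b → (Pol R ⟦ b ⟧ → Pol S ⟦ b ⟧) → Pol S ⟦ extracted t b ⟧
    carry b f with extract t b in eq
    ... | false = Pol-table (Pol-proj zero)
    ... | true  with derives-sound (p ∷ pR ∷ []) extractors (_== b) eq
    ...   | u , e , q = f (subst (Pol R ∘ ⟦_⟧) (==⇒≡ u b e) q)
  ... | u , e , q = subst (Pol S ∘ ⟦_⟧) (==⇒≡ u t e) q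

Literal : Fn n → Set
Literal g = ∃[ i ] ∃[ s ] ∀ v → g v ≡ s xor lookup v i

lookup-injective : {A : Set} (v w : Vec A n) → (∀ i → lookup v i ≡ lookup w i) → v ≡ w
lookup-injective v w e = trans (sym (tabulate∘lookup v)) (tabulate-≡ _ w e)

-- Functions with at most one sensitive coordinate at every point

xor-true : ∀ b → b xor true ≡ not b
xor-true false = refl
xor-true true  = refl

flip : Fin n → Vec Bool n → Vec Bool n
flip i v = updateAt v i not

flip-connected : (P : Vec Bool n → Set) → (∀ v i → P v → P (flip i v)) → ∀ v w → P v → P w
flip-connected P step [] [] p = p
flip-connected P step (a ∷ v) (b ∷ w) p =
  flip-connected (P ∘ (b ∷_)) (λ u i → step (b ∷ u) (suc i)) v w (move a b p)
  where
  move : ∀ a b → P (a ∷ v) → P (b ∷ v)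
  move false false q = q
  move false true  q = step (false ∷ v) zero q
  move true  false q = step (true ∷ v) zero q
  move true  true  q = q

Insensitive : Fn n → Set
Insensitive g = ∀ v i j → i ≢ j → g v ≢ g (flip i v) → g v ≡ g (flip j v)

all-vec? : {P : Vec Bool n → Set} → (∀ v → Dec (P v)) → (∃[ v ] ¬ P v) ⊎ (∀ v → P v)
all-vec? {zero} P? with P? []
... | yes p = inj₂ λ { [] → p }
... | no ¬p = inj₁ ([] , ¬p)
all-vec? {suc n} P? with all-vec? (P? ∘ (false ∷_)) | all-vec? (P? ∘ (true ∷_))
... | inj₁ (v , ¬p) | _             = inj₁ (false ∷ v , ¬p)
... | inj₂ _        | inj₁ (v , ¬p) = inj₁ (true ∷ v , ¬p)
... | inj₂ p        | inj₂ q        = inj₂ λ { (false ∷ v) → p v ; (true ∷ v) → q v }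

-- If the first coordinate is sensitive at some point, no other coordinate is sensitive at either
-- end of that edge. Moving along flips keeps both end values, so g depends on the first coordinate
-- alone. Otherwise that coordinate is dropped.
insensitive⇒literal : (g : Fn n) → Insensitive g → (∀ v w → g v ≡ g w) ⊎ Literal g
insensitive⇒literal {zero} g ins = inj₁ λ { [] [] → refl }
insensitive⇒literal {suc n} g ins with all-vec? (λ v → g (false ∷ v) ≟ᵇ g (true ∷ v))
... | inj₂ same =
  Sum.map (λ c → λ { (a ∷ v) (b ∷ w) → trans (at a v) (trans (c v w) (sym (at b w))) })
          (λ { (i , s , e) → suc i , s , λ { (a ∷ v) → trans (at a v) (e v) } })
          (insensitive⇒literal (g ∘ (false ∷_))
            λ v i j i≢j → ins (false ∷ v) (suc i) (suc j) (i≢j ∘ suc-injective))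
  where
  at : ∀ a v → g (a ∷ v) ≡ g (false ∷ v)
  at false v = refl
  at true  v = sym (same v)
... | inj₁ (v , differ) =
  inj₂ (zero , g (false ∷ v) , literal)
  where
  P : Vec Bool _ → Set
  P w = g (false ∷ w) ≡ g (false ∷ v) × g (true ∷ w) ≡ g (true ∷ v)
  step : ∀ w i → P w → P (flip i w)
  step w i (e₀ , e₁) =
      trans (sym (ins (false ∷ w) zero (suc i) (λ ()) λ e → differ (trans (sym e₀) (trans e e₁)))) e₀
    , trans (sym (ins (true ∷ w) zero (suc i) (λ ()) λ e → differ (trans (sym e₀) (trans (sym e) e₁)))) e₁
  literal : ∀ w → g w ≡ g (false ∷ v) xor lookup w zero
  literal (a ∷ w) with flip-connected P step v w (refl , refl)
  literal (false ∷ w) | e₀ , _ = trans e₀ (sym (xor-identityʳ _))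
  literal (true ∷ w) | _ , e₁ = trans e₁ (trans (¬-not (differ ∘ sym)) (sym (xor-true _)))

module _ {R : Rel k} where

  Pol-literal : Pol R ⟦ NOT ⟧ → (i : Fin n) (s : Bool) → Pol R (λ v → s xor lookup v i)
  Pol-literal p i false = Pol-proj i
  Pol-literal p i true  = Pol-ext (λ v → fun-table (λ a b c → not a) _ _ _)
    (Pol-app NOT p (Pol-proj i) (Pol-proj i) (Pol-proj i))

  -- Negation permits translating v to the origin. Coordinate i becomes the second variable, j the
  -- third, and all others the first; two sensitive coordinates would then give a `twoSensitive`
  -- table.
  Pol-insensitive : Pol R ⟦ NOT ⟧ → ¬ Pol R ⟦ XOR₃ ⟧ → {g : Fn n} → Pol R g → Insensitive g
  Pol-insensitive {n = n} p¬ ¬x {g} p v i j i≢j si =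
    decidable-stable (g v ≟ᵇ g (flip j v)) λ sj →
      ¬x (twoSensitive⇒XOR₃ (table (curry₃ h)) (sens si sj) (Pol-table ph) p¬)
    where
    var : Fin n → Fin 3
    var q with q ≟ i | q ≟ j
    ... | yes _ | _     = suc zero
    ... | no _  | yes _ = suc (suc zero)
    ... | no _  | no _  = zero
    arg : Fin n → Fn 3
    arg q w = lookup v q xor lookup w (var q)
    h : Fn 3
    h w = g (tabulate (λ q → arg q w))
    ph : Pol R h
    ph = Pol-comp p arg (λ q → Pol-literal p¬ (var q) (lookup v q))
    h₀ : h (false ∷ false ∷ false ∷ []) ≡ g v
    h₀ = cong g (tabulate-≡ _ v λ q → at q)
      where
      at : ∀ q → arg q (false ∷ false ∷ false ∷ []) ≡ lookup v q
      at q with q ≟ i | q ≟ j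
      ... | yes _ | _     = xor-identityʳ _
      ... | no _  | yes _ = xor-identityʳ _
      ... | no _  | no _  = xor-identityʳ _
    h₁ : h (false ∷ true ∷ false ∷ []) ≡ g (flip i v)
    h₁ = cong g (tabulate-≡ _ (flip i v) λ q → at q)
      where
      at : ∀ q → arg q (false ∷ true ∷ false ∷ []) ≡ lookup (flip i v) q
      at q with q ≟ i | q ≟ j
      ... | yes refl | _     = trans (xor-true _) (sym (lookup∘updateAt q v))
      ... | no q≢i  | yes _ = trans (xor-identityʳ _) (sym (lookup∘updateAt′ q i q≢i v))
      ... | no q≢i  | no _  = trans (xor-identityʳ _) (sym (lookup∘updateAt′ q i q≢i v))
    h₂ : h (false ∷ false ∷ true ∷ []) ≡ g (flip j v)
    h₂ = cong g (tabulate-≡ _ (flip j v) λ q → at q)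
      where
      at : ∀ q → arg q (false ∷ false ∷ true ∷ []) ≡ lookup (flip j v) q
      at q with q ≟ i | q ≟ j
      ... | yes refl | _       = trans (xor-identityʳ _) (sym (lookup∘updateAt′ q j i≢j v))
      ... | no _     | yes refl = trans (xor-true _) (sym (lookup∘updateAt q v))
      ... | no _     | no q≢j  = trans (xor-identityʳ _) (sym (lookup∘updateAt′ q j q≢j v))
    xor-≢ : ∀ {a b} → a ≢ b → a xor b ≡ true
    xor-≢ {false} {false} ne = contradiction refl ne
    xor-≢ {false} {true}  ne = refl
    xor-≢ {true}  {false} ne = refl
    xor-≢ {true}  {true}  ne = contradiction refl ne
    sens : g v ≢ g (flip i v) → g v ≢ g (flip j v) → twoSensitive (table (curry₃ h)) ≡ true
    sens ei ej rewrite h₀ | h₁ | h₂ | xor-≢ ei | xor-≢ ej = refl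

-- Bijections of the cube whose components are bounded by coordinates

injective⇒surjective : (σ : Fin n → Fin n) → Injective _≡_ _≡_ σ → ∀ i → ∃[ j ] σ j ≡ i
injective⇒surjective {suc n} σ inj i with any? (λ j → σ j ≟ i)
... | yes found = found
... | no ¬found = contradiction
  (injective⇒≤ {f = λ j → punchOut (avoids j)} λ {j} {j′} e →
    inj (punchOut-injective (avoids j) (avoids j′) e))
  1+n≰n
  where
  avoids : ∀ j → i ≢ σ j
  avoids j e = ¬found (j , sym e)

weight : Vec Bool n → ℕ
weight []          = 0
weight (false ∷ v) = weight v
weight (true ∷ v)  = suc (weight v)

_⊑_ : Vec Bool n → Vec Bool n → Set
v ⊑ w = ∀ i → lookup v i ≡ true → lookup w i ≡ true

⊑⇒≡⊎< : (v w : Vec Bool n) → v ⊑ w → v ≡ w ⊎ weight v < weight w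
⊑⇒≡⊎< [] [] le = inj₁ refl
⊑⇒≡⊎< (a ∷ v) (b ∷ w) le with a | b | le zero | ⊑⇒≡⊎< v w (le ∘ suc)
... | false | false | _ | inj₁ e = inj₁ (cong (false ∷_) e)
... | false | false | _ | inj₂ l = inj₂ l
... | false | true  | _ | inj₁ e = inj₂ (s≤s (subst (λ u → weight v ≤ weight u) e ≤-refl))
... | false | true  | _ | inj₂ l = inj₂ (m≤n⇒m≤1+n l)
... | true  | false | h | _      = contradiction (h refl) λ ()
... | true  | true  | _ | inj₁ e = inj₁ (cong (true ∷_) e)
... | true  | true  | _ | inj₂ l = inj₂ (s≤s l)

to-injective : (f : B n) → ∀ {v w} → Inverse.to f v ≡ Inverse.to f w → v ≡ w
to-injective f {v} {w} e = trans (sym (Inverse.strictlyInverseʳ f v))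
  (trans (cong (Inverse.from f) e) (Inverse.strictlyInverseʳ f w))

module _ (f : B n) (σ : Fin n → Fin n) (σ-inj : Injective _≡_ _≡_ σ)
         (bound : ∀ v j → component f j v ≡ true → lookup v (σ j) ≡ true) where

  private
    σ⁻¹ : Fin n → Fin n
    σ⁻¹ i = proj₁ (injective⇒surjective σ σ-inj i)

    σσ⁻¹ : ∀ i → σ (σ⁻¹ i) ≡ i
    σσ⁻¹ i = proj₂ (injective⇒surjective σ σ-inj i)

    σ⁻¹σ : ∀ j → σ⁻¹ (σ j) ≡ j
    σ⁻¹σ j = σ-inj (σσ⁻¹ (σ j))

    -- The preimage of f v under the coordinate permutation lies below v; if it were strictly
    -- below, then by induction f would take the same value on both.
    agree : ∀ v → Acc _<_ (weight v) → ∀ j → component f j v ≡ lookup v (σ j)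
    agree v (acc rec) with ⊑⇒≡⊎< u v u⊑v
      where
      u : Vec Bool n
      u = tabulate (λ i → component f (σ⁻¹ i) v)
      u⊑v : u ⊑ v
      u⊑v i e = subst (λ i → lookup v i ≡ true) (σσ⁻¹ i)
        (bound v (σ⁻¹ i) (trans (sym (lookup∘tabulate _ i)) e))
    ... | inj₁ u≡v = λ j →
      trans (sym (trans (lookup∘tabulate _ (σ j)) (cong (λ j → component f j v) (σ⁻¹σ j))))
            (cong (λ u → lookup u (σ j)) u≡v)
    ... | inj₂ u<v = λ j →
      trans (cong (component f j) (sym (to-injective f fu≡fv)))
            (trans (agree u (rec u<v) j) (cong (λ u → lookup u (σ j)) (to-injective f fu≡fv)))
      where
      u : Vec Bool n
      u = tabulate (λ i → component f (σ⁻¹ i) v)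
      fu≡fv : Inverse.to f u ≡ Inverse.to f v
      fu≡fv = lookup-injective _ _ λ j →
        trans (agree u (rec u<v) j)
              (trans (lookup∘tabulate _ (σ j)) (cong (λ j → component f j v) (σ⁻¹σ j)))

  bounded⇒coordinate : ∀ j v → component f j v ≡ lookup v (σ j)
  bounded⇒coordinate j v = agree v (<-wellFounded _) j

-- Bijections that are monotone or preserve disjointness or codisjointness

Monotone : Fn n → Set
Monotone g = ∀ v w → v ⊑ w → g v ≡ true → g w ≡ true

Disjoint : Vec Bool n → Vec Bool n → Set
Disjoint v w = ∀ i → lookup v i ∧ lookup w i ≡ false

Codisjoint : Vec Bool n → Vec Bool n → Set
Codisjoint v w = ∀ i → lookup v i ∨ lookup w i ≡ true

PreservesDisjoint PreservesCodisjoint : Fn n → Set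
PreservesDisjoint g   = ∀ v w → Disjoint v w → g v ∧ g w ≡ false
PreservesCodisjoint g = ∀ v w → Codisjoint v w → g v ∨ g w ≡ true

⊤ᵛ ⊥ᵛ : Vec Bool n
⊤ᵛ = replicate _ true
⊥ᵛ = replicate _ false

coatom atom : Fin n → Vec Bool n
coatom i = ⊤ᵛ [ i ]≔ false
atom i   = ⊥ᵛ [ i ]≔ true

coatom-at : (i : Fin n) → lookup (coatom i) i ≡ false
coatom-at i = lookup∘updateAt i ⊤ᵛ

coatom-off : {i j : Fin n} → i ≢ j → lookup (coatom j) i ≡ true
coatom-off {i = i} {j} i≢j = trans (lookup∘updateAt′ i j i≢j ⊤ᵛ) (lookup-replicate i true)

⊑coatom : (v : Vec Bool n) (i : Fin n) → lookup v i ≡ false → v ⊑ coatom i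
⊑coatom v i vi j vj with j ≟ i
... | yes refl = contradiction (trans (sym vj) vi) λ ()
... | no j≢i   = coatom-off j≢i

module _ (f : B n) (mono : ∀ j → Monotone (component f j)) where

  private
    to = Inverse.to f
    from = Inverse.from f

    to-from : ∀ v → to (from v) ≡ v
    to-from = Inverse.strictlyInverseˡ f

    to-⊤ : ∀ j → component f j ⊤ᵛ ≡ true
    to-⊤ j = mono j (from ⊤ᵛ) ⊤ᵛ (λ i _ → lookup-replicate i true)
      (trans (cong (λ v → lookup v j) (to-from ⊤ᵛ)) (lookup-replicate j true))

    -- The top vector is fixed, so the preimage of a coatom is not the top and misses some
    -- coordinate.
    gap : ∀ j → ∃[ i ] lookup (from (coatom j)) i ≢ true
    gap j = ¬∀⟶∃¬ n _ (λ i → lookup (from (coatom j)) i ≟ᵇ true) λ full →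
      case trans (sym (coatom-at j)) (trans (cong (λ v → lookup v j) (trans (sym (to-from (coatom j)))
        (cong to (lookup-injective _ ⊤ᵛ λ i → trans (full i) (sym (lookup-replicate i true))))))
        (to-⊤ j)) of λ ()

    σ : Fin n → Fin n
    σ j = proj₁ (gap j)

    to-coatom-off : ∀ j i → i ≢ j → component f i (coatom (σ j)) ≡ true
    to-coatom-off j i i≢j = mono i (from (coatom j)) (coatom (σ j))
      (⊑coatom (from (coatom j)) (σ j) (¬-not (proj₂ (gap j))))
      (trans (cong (λ v → lookup v i) (to-from (coatom j))) (coatom-off i≢j))

    -- All other components are already true there; were this one true as well, the coatom and the
    -- top would have the same image.
    to-coatom-at : ∀ j → component f j (coatom (σ j)) ≡ false
    to-coatom-at j = ¬-not λ e →
      case trans (sym (coatom-at (σ j))) (trans (cong (λ v → lookup v (σ j))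
        (to-injective f {coatom (σ j)} {⊤ᵛ} (lookup-injective _ _ λ i → trans (full e i) (sym (to-⊤ i)))))
        (lookup-replicate (σ j) true)) of λ ()
      where
      full : component f j (coatom (σ j)) ≡ true → ∀ i → component f i (coatom (σ j)) ≡ true
      full e i with i ≟ j
      ... | yes refl = e
      ... | no i≢j   = to-coatom-off j i i≢j

    σ-inj : Injective _≡_ _≡_ σ
    σ-inj {i} {j} e with i ≟ j
    ... | yes i≡j = i≡j
    ... | no i≢j  = case trans (sym (to-coatom-off j i i≢j))
                       (trans (cong (λ s → component f i (coatom s)) (sym e)) (to-coatom-at i)) of λ ()

  -- A vector missing coordinate σ j lies below `coatom (σ j)`, where component j is false; hence
  -- component j is bounded by that coordinate.
  monotone⇒literal : ∀ j → Literal (component f j)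
  monotone⇒literal j = σ j , false , bounded⇒coordinate f σ σ-inj bound j
    where
    bound : ∀ v j → component f j v ≡ true → lookup v (σ j) ≡ true
    bound v j e with lookup v (σ j) in eq
    ... | true  = refl
    ... | false = case trans (sym (to-coatom-at j))
                           (mono j v (coatom (σ j)) (⊑coatom v (σ j) eq) e) of λ ()

Disjoint-atom : (v : Vec Bool n) (i : Fin n) → lookup v i ≡ false → Disjoint v (atom i)
Disjoint-atom v i vi j with j ≟ i
... | yes refl = cong (_∧ lookup (atom i) i) vi
... | no j≢i   =
  trans (cong (lookup v j ∧_) (trans (lookup∘updateAt′ j i j≢i ⊥ᵛ) (lookup-replicate j false)))
        (∧-zeroʳ _)

module _ (f : B n) (disj : ∀ j → PreservesDisjoint (component f j)) where

  private
    to = Inverse.to f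

    atom-at : (i : Fin n) → lookup (atom i) i ≡ true
    atom-at i = lookup∘updateAt i ⊥ᵛ

    ∧-idem-false : ∀ {b} → b ∧ b ≡ false → b ≡ false
    ∧-idem-false {false} _ = refl

    to-⊥ : ∀ j → component f j ⊥ᵛ ≡ false
    to-⊥ j = ∧-idem-false (disj j ⊥ᵛ ⊥ᵛ λ i → cong (λ b → b ∧ b) (lookup-replicate i false))

    -- The zero vector is disjoint from itself, so it is fixed, and by injectivity an atom is not
    -- sent to it.
    hit : ∀ i → ∃[ j ] component f j (atom i) ≢ false
    hit i = ¬∀⟶∃¬ n _ (λ j → component f j (atom i) ≟ᵇ false) λ none →
      case trans (sym (atom-at i)) (trans (cong (λ v → lookup v i)
        (to-injective f {atom i} {⊥ᵛ} (lookup-injective _ _ λ j → trans (none j) (sym (to-⊥ j)))))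
        (lookup-replicate i false)) of λ ()

    ρ : Fin n → Fin n
    ρ i = proj₁ (hit i)

    to-atom : ∀ i → component f (ρ i) (atom i) ≡ true
    to-atom i = ¬-not (proj₂ (hit i))

    -- A vector missing i is disjoint from `atom i`, on which component ρ i is true.
    ρ-bound : ∀ v i → component f (ρ i) v ≡ true → lookup v i ≡ true
    ρ-bound v i e with lookup v i in eq
    ... | true  = refl
    ... | false = case trans (sym (cong₂ _∧_ e (to-atom i)))
                           (disj (ρ i) v (atom i) (Disjoint-atom v i eq)) of λ ()

    ρ-inj : Injective _≡_ _≡_ ρ
    ρ-inj {i} {j} e with i ≟ j
    ... | yes i≡j = i≡j
    ... | no i≢j  = case trans
                       (sym (ρ-bound (atom j) i (trans (cong (λ r → component f r (atom j)) e) (to-atom j))))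
                       (trans (lookup∘updateAt′ i j i≢j ⊥ᵛ) (lookup-replicate i false)) of λ ()

    σ : Fin n → Fin n
    σ j = proj₁ (injective⇒surjective ρ ρ-inj j)

    ρσ : ∀ j → ρ (σ j) ≡ j
    ρσ j = proj₂ (injective⇒surjective ρ ρ-inj j)

    σ-inj : Injective _≡_ _≡_ σ
    σ-inj {i} {j} e = trans (sym (ρσ i)) (trans (cong ρ e) (ρσ j))

  disjoint⇒coordinate : ∀ j → ∃[ i ] ∀ v → component f j v ≡ lookup v i
  disjoint⇒coordinate j = σ j , bounded⇒coordinate f σ σ-inj
    (λ v j e → ρ-bound v (σ j) (trans (cong (λ j → component f j v) (ρσ j)) e)) j

  disjoint⇒literal : ∀ j → Literal (component f j)
  disjoint⇒literal j = proj₁ (disjoint⇒coordinate j) , false , proj₂ (disjoint⇒coordinate j)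

map-not-involutive : (v : Vec Bool n) → map not (map not v) ≡ v
map-not-involutive v = trans (sym (map-∘ not not v)) (trans (map-cong not-involutive v) (map-id v))

conjugate-inverse : {f g : Vec Bool n → Vec Bool n} → (∀ v → f (g v) ≡ v) →
                    ∀ v → map not (f (map not (map not (g (map not v))))) ≡ v
conjugate-inverse {f = f} {g} fg v = begin
  map not (f (map not (map not (g (map not v)))))
    ≡⟨ cong (map not ∘ f) (map-not-involutive (g (map not v))) ⟩
  map not (f (g (map not v)))                     ≡⟨ cong (map not) (fg (map not v)) ⟩
  map not (map not v)                             ≡⟨ map-not-involutive v ⟩
  v                                               ∎
  where open ≡-Reasoning

-- Conjugation by complementing all bits exchanges disjointness and codisjointness and fixes
-- coordinate functions.
dual : B n → B n
dual f = mk↔ₛ′ (λ v → map not (Inverse.to f (map not v))) (λ v → map not (Inverse.from f (map not v)))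
  (conjugate-inverse {f = Inverse.to f} {g = Inverse.from f} (Inverse.strictlyInverseˡ f))
  (conjugate-inverse {f = Inverse.from f} {g = Inverse.to f} (Inverse.strictlyInverseʳ f))

component-dual : (f : B n) (j : Fin n) (v : Vec Bool n) →
                 component (dual f) j v ≡ not (component f j (map not v))
component-dual f j v = lookup-map j not (Inverse.to f (map not v))

module _ (f : B n) (codisj : ∀ j → PreservesCodisjoint (component f j)) where

  private
    deMorgan : ∀ a b → a ∧ b ≡ false → not a ∨ not b ≡ true
    deMorgan false b     e = refl
    deMorgan true  false e = refl

    deMorgan′ : ∀ a b → a ∨ b ≡ true → not a ∧ not b ≡ false
    deMorgan′ true  b    e = refl
    deMorgan′ false true e = refl

    disj : ∀ j → PreservesDisjoint (component (dual f) j)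
    disj j v w d =
      trans (cong₂ _∧_ (component-dual f j v) (component-dual f j w))
        (deMorgan′ (component f j (map not v)) (component f j (map not w))
          (codisj j (map not v) (map not w) λ i →
            trans (cong₂ _∨_ (lookup-map i not v) (lookup-map i not w))
              (deMorgan (lookup v i) (lookup w i) (d i))))

    undual : ∀ j i → (∀ v → component (dual f) j v ≡ lookup v i) → ∀ v → component f j v ≡ lookup v i
    undual j i e v = begin
      component f j v                                 ≡⟨ cong (component f j) (map-not-involutive v) ⟨
      component f j (map not (map not v))
        ≡⟨ not-involutive (component f j (map not (map not v))) ⟨
      not (not (component f j (map not (map not v)))) ≡⟨ cong not (component-dual f j (map not v)) ⟨
      not (component (dual f) j (map not v))          ≡⟨ cong not (e (map not v)) ⟩
      not (lookup (map not v) i)                      ≡⟨ cong not (lookup-map i not v) ⟩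
      not (not (lookup v i))                          ≡⟨ not-involutive (lookup v i) ⟩
      lookup v i                                      ∎
      where open ≡-Reasoning

  codisjoint⇒literal : ∀ j → Literal (component f j)
  codisjoint⇒literal j = i , false , undual j i (proj₂ (disjoint⇒coordinate (dual f) disj j))
    where
    i : Fin n
    i = proj₁ (disjoint⇒coordinate (dual f) disj j)

-- Deciding whether a ternary function is a polymorphism

rows : Vec Bool k → Vec Bool k → Vec Bool k → Vec (Vec Bool 3) k
rows [] [] [] = []
rows (a ∷ as) (b ∷ bs) (c ∷ cs) = (a ∷ b ∷ c ∷ []) ∷ rows as bs cs

rows-columns : (M : Vec (Vec Bool 3) k) →
               rows (column zero M) (column (suc zero) M) (column (suc (suc zero)) M) ≡ M
rows-columns [] = refl
rows-columns ((a ∷ b ∷ c ∷ []) ∷ M) = cong ((a ∷ b ∷ c ∷ []) ∷_) (rows-columns M)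

column-rows₀ : (a b c : Vec Bool k) → column zero (rows a b c) ≡ a
column-rows₀ [] [] [] = refl
column-rows₀ (a ∷ as) (b ∷ bs) (c ∷ cs) = cong (a ∷_) (column-rows₀ as bs cs)

column-rows₁ : (a b c : Vec Bool k) → column (suc zero) (rows a b c) ≡ b
column-rows₁ [] [] [] = refl
column-rows₁ (a ∷ as) (b ∷ bs) (c ∷ cs) = cong (b ∷_) (column-rows₁ as bs cs)

column-rows₂ : (a b c : Vec Bool k) → column (suc (suc zero)) (rows a b c) ≡ c
column-rows₂ [] [] [] = refl
column-rows₂ (a ∷ as) (b ∷ bs) (c ∷ cs) = cong (c ∷_) (column-rows₂ as bs cs)

-- Enumerating columns instead of rows lets each column be tested for membership in R before the
-- next is chosen.
member : Rel k → Table → Bool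
member {k} R t =
  every k λ a → R a ⇒ every k λ b → R b ⇒ every k λ c → R c ⇒ R (map ⟦ t ⟧ (rows a b c))

⇒-intro : ∀ {a b} → (a ≡ true → b ≡ true) → (a ⇒ b) ≡ true
⇒-intro {false} h = refl
⇒-intro {true}  h = h refl

module _ {R : Rel k} where

  member⇒Pol : ∀ t → member R t ≡ true → Pol R ⟦ t ⟧
  member⇒Pol t e = pol λ M c →
    let a₀ = column zero M
        a₁ = column (suc zero) M
        a₂ = column (suc (suc zero)) M
    in subst (λ M → map ⟦ t ⟧ M ∈R R) (rows-columns M)
         (⇒-elim (every-sound (p₂ a₀ a₁)
           (⇒-elim (every-sound (p₁ a₀)
             (⇒-elim (every-sound p₀ e a₀) (c zero)) a₁) (c (suc zero))) a₂) (c (suc (suc zero))))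
    where
    p₂ : Vec Bool k → Vec Bool k → Vec Bool k → Bool
    p₂ a b c = R c ⇒ R (map ⟦ t ⟧ (rows a b c))
    p₁ : Vec Bool k → Vec Bool k → Bool
    p₁ a b = R b ⇒ every k (p₂ a b)
    p₀ : Vec Bool k → Bool
    p₀ a = R a ⇒ every k (p₁ a)

  Pol⇒member : ∀ t → Pol R ⟦ t ⟧ → member R t ≡ true
  Pol⇒member t p =
    every-complete _ λ a → ⇒-intro λ Ra →
    every-complete _ λ b → ⇒-intro λ Rb →
    every-complete _ λ c → ⇒-intro λ Rc →
    Pol.preserves p (rows a b c) λ where
      zero             → trans (cong R (column-rows₀ a b c)) Ra
      (suc zero)       → trans (cong R (column-rows₁ a b c)) Rb
      (suc (suc zero)) → trans (cong R (column-rows₂ a b c)) Rc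

  Pol? : ∀ t → Dec (Pol R ⟦ t ⟧)
  Pol? t = map′ (member⇒Pol t) (Pol⇒member t) (member R t ≟ᵇ true)

minor : Fn m → (Fin m → Fin n) → Fn n
minor g σ v = g (tabulate (λ i → lookup v (σ i)))

minor-≡ : (g : Fn m) (σ : Fin m → Fin n) (u : Vec Bool n) (v : Vec Bool m) →
          (∀ i → lookup u (σ i) ≡ lookup v i) → minor g σ u ≡ g v
minor-≡ g σ u v e = cong g (tabulate-≡ _ v e)

-- Without x + y + z

module _ {R : Rel k} where

  -- Coordinates are sorted into three classes by their values in v and w; u₁ and u₂ list those
  -- values class by class, so the minor at u₁ and u₂ reproduces g at v and w.
  pair-minor : {g : Fn n} → Pol R g → (select : Bool → Bool → Fin 3)
               (u₁ u₂ : Vec Bool 3) (v w : Vec Bool n) →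
               (∀ i → lookup u₁ (select (lookup v i) (lookup w i)) ≡ lookup v i) →
               (∀ i → lookup u₂ (select (lookup v i) (lookup w i)) ≡ lookup w i) →
               ∃[ t ] Pol R ⟦ t ⟧ × ⟦ t ⟧ u₁ ≡ g v × ⟦ t ⟧ u₂ ≡ g w
  pair-minor {n = n} {g} p select u₁ u₂ v w e₁ e₂ =
    table (curry₃ (minor g σ)) , Pol-table (Pol-minor p σ) ,
    trans (⟦table⟧ u₁) (minor-≡ g σ u₁ v e₁) , trans (⟦table⟧ u₂) (minor-≡ g σ u₂ w e₂)
    where
    σ : Fin n → Fin 3
    σ i = select (lookup v i) (lookup w i)
    ⟦table⟧ : ∀ u → ⟦ table (curry₃ (minor g σ)) ⟧ u ≡ minor g σ u
    ⟦table⟧ (a ∷ b ∷ c ∷ []) = fun-table (curry₃ (minor g σ)) a b c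

  no-nonmonotone⇒Monotone : (∀ t → nonmonotone t ≡ true → ¬ Pol R ⟦ t ⟧) →
                            {g : Fn n} → Pol R g → Monotone g
  no-nonmonotone⇒Monotone none {g} p v w v⊑w gv = decidable-stable (g w ≟ᵇ true) λ ¬gw →
    let t , q , e₁ , e₂ = pair-minor p select (false ∷ false ∷ true ∷ []) (false ∷ true ∷ true ∷ []) v w
                            (λ i → first (lookup v i) (lookup w i))
                            (λ i → second (lookup v i) (lookup w i) (v⊑w i))
    in none t (cong₂ (λ a b → a ∧ not b) (trans e₁ gv) (trans e₂ (¬-not ¬gw))) q
    where
    select : Bool → Bool → Fin 3
    select false false = zero
    select false true  = suc zero
    select true  _     = suc (suc zero)
    first : ∀ a b → lookup (false ∷ false ∷ true ∷ []) (select a b) ≡ a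
    first false false = refl
    first false true  = refl
    first true  _     = refl
    second : ∀ a b → (a ≡ true → b ≡ true) → lookup (false ∷ true ∷ true ∷ []) (select a b) ≡ b
    second false false h = refl
    second false true  h = refl
    second true  b     h = sym (h refl)

  no-nondisjoint⇒PreservesDisjoint :
    (∀ t → nondisjoint t ≡ true → ¬ Pol R ⟦ t ⟧) →
    {g : Fn n} → Pol R g → PreservesDisjoint g
  no-nondisjoint⇒PreservesDisjoint none p v w d = ¬-not λ e →
    let t , q , e₁ , e₂ = pair-minor p select (false ∷ true ∷ false ∷ []) (false ∷ false ∷ true ∷ []) v w
                            (λ i → first (lookup v i) (lookup w i))
                            (λ i → second (lookup v i) (lookup w i) (d i))
    in none t (trans (cong₂ _∧_ e₁ e₂) e) q
    where
    select : Bool → Bool → Fin 3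
    select false false = zero
    select true  _     = suc zero
    select false true  = suc (suc zero)
    first : ∀ a b → lookup (false ∷ true ∷ false ∷ []) (select a b) ≡ a
    first false false = refl
    first false true  = refl
    first true  _     = refl
    second : ∀ a b → a ∧ b ≡ false → lookup (false ∷ false ∷ true ∷ []) (select a b) ≡ b
    second false false h = refl
    second false true  h = refl
    second true  b     h = sym h

  no-noncodisjoint⇒PreservesCodisjoint :
    (∀ t → noncodisjoint t ≡ true → ¬ Pol R ⟦ t ⟧) →
    {g : Fn n} → Pol R g → PreservesCodisjoint g
  no-noncodisjoint⇒PreservesCodisjoint none p v w d = decidable-stable (_ ≟ᵇ true) λ ¬e →
    let t , q , e₁ , e₂ = pair-minor p select (true ∷ false ∷ true ∷ []) (true ∷ true ∷ false ∷ []) v w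
                            (λ i → first (lookup v i) (lookup w i))
                            (λ i → second (lookup v i) (lookup w i) (d i))
    in none t (cong not (trans (cong₂ _∨_ e₁ e₂) (¬-not ¬e))) q
    where
    select : Bool → Bool → Fin 3
    select true  true  = zero
    select false _     = suc zero
    select true  false = suc (suc zero)
    first : ∀ a b → lookup (true ∷ false ∷ true ∷ []) (select a b) ≡ a
    first true  true  = refl
    first true  false = refl
    first false _     = refl
    second : ∀ a b → a ∨ b ≡ true → lookup (true ∷ true ∷ false ∷ []) (select a b) ≡ b
    second true  true  h = refl
    second true  false h = refl
    second false b     h = sym h

  module _ (¬xor₃ : ¬ Pol R ⟦ XOR₃ ⟧) (f : B n) (p : ∀ j → Pol R (component f j)) where

    private
      -- The preimages of the two constant vectors give both values.
      nonconstant : ∀ j → ¬ (∀ v w → component f j v ≡ component f j w)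
      nonconstant j const-j = case trans (sym (value false)) (trans (const-j _ _) (value true)) of λ ()
        where
        value : ∀ b → component f j (Inverse.from f (replicate n b)) ≡ b
        value b = trans (cong (λ v → lookup v j) (Inverse.strictlyInverseˡ f (replicate n b)))
                        (lookup-replicate j b)

      literal-with-negation : Pol R ⟦ NOT ⟧ → ∀ j → Literal (component f j)
      literal-with-negation p¬ j = fromInj₂ (λ c → contradiction c (nonconstant j))
        (insensitive⇒literal (component f j) (Pol-insensitive p¬ ¬xor₃ (p j)))

      module _ (¬neg : ¬ Pol R ⟦ NOT ⟧) where

        monotone : (∀ t → nonmonotone t ≡ true → ¬ Pol R ⟦ t ⟧) → ∀ j → Literal (component f j)
        monotone none = monotone⇒literal f λ j → no-nonmonotone⇒Monotone none (p j)

        -- Call 0 or ∧ a bottom and 1 or ∨ a top. With both or with neither, a nonmonotone member is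
        -- contradictory. With a bottom only, a violation of disjointness would create a top; dually
        -- with a top only.
        literal-without-negation : Dec (Pol R ⟦ ZERO ⟧ ⊎ Pol R ⟦ AND ⟧) →
                                   Dec (Pol R ⟦ ONE ⟧ ⊎ Pol R ⟦ OR ⟧) →
                                   ∀ j → Literal (component f j)
        literal-without-negation (yes (inj₁ p₀)) (yes (inj₁ p₁)) =
          monotone λ t nm q → nonmonotone-0-1 ¬neg ¬xor₃ t nm q p₀ p₁
        literal-without-negation (yes (inj₁ p₀)) (yes (inj₂ p∨)) =
          monotone λ t nm q → nonmonotone-0-∨ ¬neg ¬xor₃ t nm q p₀ p∨
        literal-without-negation (yes (inj₂ p∧)) (yes (inj₁ p₁)) =
          monotone λ t nm q → nonmonotone-∧-1 ¬neg ¬xor₃ t nm q p∧ p₁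
        literal-without-negation (yes (inj₂ p∧)) (yes (inj₂ p∨)) =
          monotone λ t nm q → nonmonotone-∧-∨ ¬neg ¬xor₃ t nm q p∧ p∨
        literal-without-negation (no ¬bot) (no ¬top) =
          monotone λ t nm q → case nonmonotone⇒extremum ¬neg ¬xor₃ t nm q of λ where
            (here r)                         → ¬bot (inj₁ r)
            (there (here r))                 → ¬top (inj₁ r)
            (there (there (here r)))         → ¬bot (inj₂ r)
            (there (there (there (here r)))) → ¬top (inj₂ r)
        literal-without-negation (yes bot) (no ¬top) =
          disjoint⇒literal f λ j → no-nondisjoint⇒PreservesDisjoint
            (λ t nd q → ¬top (nondisjoint⇒top ¬neg ¬xor₃ t q nd bot)) (p j)
        literal-without-negation (no ¬bot) (yes top) =
          codisjoint⇒literal f λ j → no-noncodisjoint⇒PreservesCodisjoint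
            (λ t nd q → ¬bot (noncodisjoint⇒bottom ¬neg ¬xor₃ t q nd top)) (p j)

    component-literal : Dec (Pol R ⟦ NOT ⟧) → ∀ j → Literal (component f j)
    component-literal (yes p¬)  = literal-with-negation p¬
    component-literal (no ¬neg) =
      literal-without-negation ¬neg (Pol? ZERO ⊎-dec Pol? AND) (Pol? ONE ⊎-dec Pol? OR)

-- A coordinate lies in every clone, and identifying all variables of a negated coordinate gives ¬
-- itself.
transfer-literal : {R : Rel k} {S : Rel l} → (Pol R ⟦ NOT ⟧ → Pol S ⟦ NOT ⟧) →
                   {g : Fn n} → Literal g → Pol R g → Pol S g
transfer-literal t¬ (i , false , e) p = Pol-ext (sym ∘ e) (Pol-proj i)
transfer-literal {R = R} t¬ {g} (i , true , e) p =
  Pol-ext (sym ∘ e) (Pol-literal (t¬ neg) i true)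
  where
  neg : Pol R ⟦ NOT ⟧
  neg = Pol-ext (λ { u@(a ∷ b ∷ c ∷ []) → trans (e (tabulate (λ _ → a)))
                       (trans (cong not (lookup∘tabulate (λ _ → a) i))
                         (sym (fun-table (λ a b c → not a) a b c))) })
                (Pol-minor p (λ _ → zero))

-- With x + y + z

module _ {R : Rel k} {S : Rel l} where

  -- Used with n < m in the inductions: the minor along σ is transferred at its smaller arity and
  -- then expanded along τ.
  transfer-factor : {g : Fn m} (σ : Fin m → Fin n) (τ : Fin n → Fin m) →
                    (Pol R (minor g σ) → Pol S (minor g σ)) → Pol R g → Pol S (minor g (τ ∘ σ))
  transfer-factor {g = g} σ τ t p =
    Pol-ext (λ v → cong g (tabulate-cong λ i → lookup∘tabulate (λ j → lookup v (τ j)) (σ i)))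
            (Pol-minor (t (Pol-minor p σ)) τ)

-- A merge identifies two variables and renumbers the rest; the matching skip undoes the
-- renumbering. Their composite replaces the later of the two variables by the earlier one.
merge₀₁ : Fin (suc (suc n)) → Fin (suc n)
merge₀₁ zero    = zero
merge₀₁ (suc i) = i

skip₁ : Fin (suc n) → Fin (suc (suc n))
skip₁ zero    = zero
skip₁ (suc i) = suc (suc i)

merge₀₂ merge₁₂ : Fin (suc (suc (suc n))) → Fin (suc (suc n))
merge₀₂ zero          = zero
merge₀₂ (suc zero)    = suc zero
merge₀₂ (suc (suc zero)) = zero
merge₀₂ (suc (suc (suc i))) = suc (suc i)
merge₁₂ zero    = zero
merge₁₂ (suc i) = suc (merge₀₁ i)

skip₂ : Fin (suc (suc n)) → Fin (suc (suc (suc n)))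
skip₂ zero    = zero
skip₂ (suc i) = suc (skip₁ i)

collapse₂ : Fin (suc (suc n)) → Fin 2
collapse₂ zero          = zero
collapse₂ (suc zero)    = suc zero
collapse₂ (suc (suc i)) = zero

include₂ : Fin 2 → Fin (suc (suc n))
include₂ zero       = zero
include₂ (suc zero) = suc zero

xor-false⇒≡ : ∀ a b → a xor b ≡ false → a ≡ b
xor-false⇒≡ false false e = refl
xor-false⇒≡ true  true  e = refl

xor₃-same : ∀ a b → a ≡ a xor (b xor b)
xor₃-same false false = refl
xor₃-same false true  = refl
xor₃-same true  false = refl
xor₃-same true  true  = refl

module _ {R : Rel k} (px : Pol R ⟦ XOR₃ ⟧) (¬maj : ¬ Pol R ⟦ MAJ ⟧)
         {g : Fn (suc (suc n))} (p : Pol R g) where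

  private
    m₀₁ m₀₂ m₀ : Fn (suc (suc n))
    m₀₁ = minor g (skip₁ ∘ merge₀₁)
    m₀₂ = minor g (include₂ ∘ collapse₂)
    m₀  = minor g (λ _ → zero)

    -- Coordinates of r equal to a join the first variable, and the others form the third. The four
    -- terms of the identity are then the values of this ternary minor on the face x = a, and an odd
    -- sum would yield maj.
    affine-≢ : ∀ a r → let v = a ∷ not a ∷ r in g v ≡ m₀₁ v xor (m₀₂ v xor m₀ v)
    affine-≢ a r = xor-false⇒≡ _ _ (trans (sym parity) (¬-not λ e →
      ¬maj (nonaffine⇒MAJ t (odd a e) (Pol-table (Pol-minor p σ)) px)))
      where
      select : Bool → Fin 3
      select b = if b xor a then suc (suc zero) else zero
      σ : Fin (suc (suc n)) → Fin 3
      σ zero          = zero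
      σ (suc zero)    = suc zero
      σ (suc (suc i)) = select (lookup r i)
      h : Fn 3
      h = minor g σ
      t : Table
      t = table (curry₃ h)
      odd : ∀ a → faceParity t a ≡ true → faceParity t false ∨ faceParity t true ≡ true
      odd false e = cong (_∨ faceParity t true) e
      odd true  e = trans (cong (faceParity t false ∨_) e) (∨-zeroʳ (faceParity t false))
      select-not : ∀ a c b → lookup (a ∷ c ∷ not a ∷ []) (if b xor a then suc (suc zero) else zero) ≡ b
      select-not false c false = refl
      select-not false c true  = refl
      select-not true  c false = refl
      select-not true  c true  = refl
      select-same : ∀ c b → lookup (a ∷ c ∷ a ∷ []) (select b) ≡ a
      select-same c b with b xor a
      ... | false = refl
      ... | true  = refl
      at : ∀ b c v → minor g σ (a ∷ b ∷ c ∷ []) ≡ v → fun t a b c ≡ v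
      at b c v e = trans (fun-table (curry₃ h) a b c) e
      parity : let v = a ∷ not a ∷ r in faceParity t a ≡ g v xor (m₀₁ v xor (m₀₂ v xor m₀ v))
      parity = cong₂ _xor_
        (at (not a) (not a) _ (cong g (cong (λ r → a ∷ not a ∷ r)
          (tabulate-≡ _ r λ i → select-not a (not a) (lookup r i)))))
        (cong₂ _xor_
          (at a (not a) _ (cong g (cong (λ r → a ∷ a ∷ r)
            (tabulate-cong λ i → select-not a a (lookup r i)))))
          (cong₂ _xor_
            (at (not a) a _ (cong g (cong (λ r → a ∷ not a ∷ r)
              (tabulate-cong λ i → select-same (not a) (lookup r i)))))
            (at a a _ (cong g (cong (λ r → a ∷ a ∷ r)
              (tabulate-cong λ i → select-same a (lookup r i)))))))

  affine : ∀ v → g v ≡ m₀₁ v xor (m₀₂ v xor m₀ v)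
  -- When the first two arguments agree, the last two summands coincide and cancel.
  affine (false ∷ false ∷ r) =
    trans (cong (λ r → g (false ∷ false ∷ r)) (sym (tabulate∘lookup r)))
          (xor₃-same _ (m₀ (false ∷ false ∷ r)))
  affine (false ∷ true  ∷ r) = affine-≢ false r
  affine (true  ∷ false ∷ r) = affine-≢ true r
  affine (true  ∷ true  ∷ r) =
    trans (cong (λ r → g (true ∷ true ∷ r)) (sym (tabulate∘lookup r)))
          (xor₃-same _ (m₀ (true ∷ true ∷ r)))

-- If a = b the inner discriminators return c and d, and the outer one returns c. Otherwise both
-- return a, and the outer one returns d.
switch : Bool → Bool → Bool → Bool → Bool
switch a b c d = fun DISC (fun DISC a b c) (fun DISC a b d) d

switch-≡ : ∀ a c d → switch a a c d ≡ c
switch-≡ false false false = refl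
switch-≡ false false true  = refl
switch-≡ false true  false = refl
switch-≡ false true  true  = refl
switch-≡ true  false false = refl
switch-≡ true  false true  = refl
switch-≡ true  true  false = refl
switch-≡ true  true  true  = refl

switch-not : ∀ a c d → switch a (not a) c d ≡ d
switch-not false false false = refl
switch-not false false true  = refl
switch-not false true  false = refl
switch-not false true  true  = refl
switch-not true  false false = refl
switch-not true  false true  = refl
switch-not true  true  false = refl
switch-not true  true  true  = refl

-- Two of the first three arguments coincide.
switch-merge : (g : Fn (suc (suc (suc n)))) → ∀ v →
  switch (lookup v zero) (lookup v (suc zero)) (minor g (skip₁ ∘ merge₀₁) v)
    (switch (lookup v zero) (lookup v (suc (suc zero))) (minor g (skip₂ ∘ merge₀₂) v)
      (minor g (skip₂ ∘ merge₁₂) v)) ≡ g v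
switch-merge g (a ∷ b ∷ c ∷ r) with b ≟ᵇ a | c ≟ᵇ a
... | yes refl | _        = trans (switch-≡ a _ _) (cong (λ r → g (a ∷ a ∷ c ∷ r)) (tabulate∘lookup r))
... | no b≢a   | yes refl rewrite ¬-not b≢a =
  trans (switch-not a _ _) (trans (switch-≡ a _ _)
    (cong (λ r → g (a ∷ not a ∷ a ∷ r)) (tabulate∘lookup r)))
... | no b≢a   | no c≢a rewrite ¬-not b≢a | ¬-not c≢a =
  trans (switch-not a _ _) (trans (switch-not a _ _)
    (cong (λ r → g (a ∷ not a ∷ not a ∷ r)) (tabulate∘lookup r)))

module _ {R : Rel k} {S : Rel l} (pR : Pol R ⟦ XOR₃ ⟧) (pS : Pol S ⟦ XOR₃ ⟧)
         (t0 : Pol R ⟦ ZERO ⟧ → Pol S ⟦ ZERO ⟧) (t1 : Pol R ⟦ ONE ⟧ → Pol S ⟦ ONE ⟧)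
         (t¬ : Pol R ⟦ NOT ⟧ → Pol S ⟦ NOT ⟧) (t∧ : Pol R ⟦ AND ⟧ → Pol S ⟦ AND ⟧) where

  private
    transfer₂ : {g : Fn 2} → Pol R g → Pol S g
    transfer₂ {g} p = Pol-ext back (Pol-minor
      (transfer-binary pR pS t0 t1 t¬ t∧ t bin (Pol-table (Pol-minor p embed))) retract)
      where
      embed : Fin 2 → Fin 3
      embed zero       = zero
      embed (suc zero) = suc zero
      retract : Fin 3 → Fin 2
      retract zero             = zero
      retract (suc zero)       = suc zero
      retract (suc (suc zero)) = zero
      h : Bool → Bool → Bool → Bool
      h = curry₃ (minor g embed)
      t : Table
      t = table h
      bin : binary t ≡ true
      bin = every-complete (ignoresLast t) λ { (a ∷ b ∷ c ∷ []) →
        trans (cong₂ (λ p q → not (p xor q)) (fun-table h a b c) (fun-table h a b false))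
              (cong not (xor-same (g (a ∷ b ∷ [])))) }
      back : minor ⟦ t ⟧ retract ≗ g
      back (a ∷ b ∷ []) = fun-table h a b a

    transfer₁ : {g : Fn 1} → Pol R g → Pol S g
    transfer₁ {g} p = Pol-ext (λ { (a ∷ []) → refl })
      (Pol-minor {n = 1} (transfer₂ (Pol-minor p (λ _ → zero))) (λ _ → zero))

  -- Induction on the arity: `affine` writes g as the sum of a minor with one variable fewer, a
  -- binary minor and a unary one.
  transfer-affine : ¬ Pol R ⟦ MAJ ⟧ → {g : Fn (suc n)} → Pol R g → Pol S g
  transfer-affine {n = zero}  ¬maj p = transfer₁ p
  transfer-affine {n = suc n} ¬maj {g} p =
    Pol-ext (λ v → trans (fun-table (λ a b c → a xor (b xor c)) (minor g (skip₁ ∘ merge₀₁) v)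
                            (minor g (include₂ ∘ collapse₂) v) (minor g (λ _ → zero) v))
                         (sym (affine pR ¬maj p v)))
      (Pol-app XOR₃ pS (transfer-factor merge₀₁ skip₁ (transfer-affine ¬maj) p)
                       (transfer-factor collapse₂ include₂ transfer₂ p)
                       (transfer-factor (λ _ → zero) (λ _ → zero) transfer₁ p))

  -- Induction on the arity: `switch-merge` recovers g from three minors with one variable fewer,
  -- and the clone of S contains the switch.
  transfer-nonaffine : Pol S ⟦ MAJ ⟧ → {g : Fn (suc n)} → Pol R g → Pol S g
  transfer-nonaffine {n = zero} maj p = transfer₁ p
  transfer-nonaffine {n = suc zero} maj p = transfer₂ p
  transfer-nonaffine {n = suc (suc n)} maj {g} p = Pol-ext (switch-merge g)
    (Pol-switch (Pol-proj zero) (Pol-proj (suc zero))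
      (transfer-factor merge₀₁ skip₁ (transfer-nonaffine maj) p)
      (Pol-switch (Pol-proj zero) (Pol-proj (suc (suc zero)))
        (transfer-factor merge₀₂ skip₂ (transfer-nonaffine maj) p)
        (transfer-factor merge₁₂ skip₂ (transfer-nonaffine maj) p)))
    where
    disc : Pol S ⟦ DISC ⟧
    disc = MAJ-XOR₃⇒DISC maj pS
    Pol-switch : {a b c d : Fn m} → Pol S a → Pol S b → Pol S c → Pol S d →
                 Pol S (λ v → switch (a v) (b v) (c v) (d v))
    Pol-switch pa pb pc pd =
      Pol-app DISC disc (Pol-app DISC disc pa pb pc) (Pol-app DISC disc pa pb pd) pd

-- Six tests determine the permutation clone

record SameTests (R : Rel k) (S : Rel l) : Set where
  field
    xor₃ : member R XOR₃ ≡ member S XOR₃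
    neg  : member R NOT ≡ member S NOT
    -- Without x + y + z all components are literals, so only ¬ is compared.
    rest : member R XOR₃ ≡ true → All (λ t → member R t ≡ member S t) (MAJ ∷ ZERO ∷ ONE ∷ AND ∷ [])

open SameTests

SameTests-sym : {R : Rel k} {S : Rel l} → SameTests R S → SameTests S R
SameTests-sym s .xor₃ = sym (s .xor₃)
SameTests-sym s .neg  = sym (s .neg)
SameTests-sym s .rest e = All.map sym (s .rest (trans (s .xor₃) e))

module _ {R : Rel k} {S : Rel l} where

  transfer-member : (t : Table) → member R t ≡ member S t → Pol R ⟦ t ⟧ → Pol S ⟦ t ⟧
  transfer-member t e p = member⇒Pol t (trans (sym e) (Pol⇒member t p))

  SameTests⇒PPol-⊆ : SameTests R S → (f : B n) → PPol R n f → PPol S n f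
  SameTests⇒PPol-⊆ {n = n} s f pf = Pol⇒PPol f (transfer (Pol? XOR₃) (Pol? MAJ))
    where
    p : ∀ j → Pol R (component f j)
    p = PPol⇒Pol f pf

    neg⇒ : Pol R ⟦ NOT ⟧ → Pol S ⟦ NOT ⟧
    neg⇒ = transfer-member NOT (s .neg)

    transfer⁺ : Dec (Pol R ⟦ MAJ ⟧) → Pol R ⟦ XOR₃ ⟧ → {g : Fn (suc m)} → Pol R g → Pol S g
    transfer⁺ maj? pR with s .rest (Pol⇒member XOR₃ pR)
    transfer⁺ (yes maj) pR | m ∷ z ∷ o ∷ a ∷ [] =
      transfer-nonaffine pR (transfer-member XOR₃ (s .xor₃) pR) (transfer-member ZERO z)
        (transfer-member ONE o) neg⇒ (transfer-member AND a) (transfer-member MAJ m maj)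
    transfer⁺ (no ¬maj) pR | m ∷ z ∷ o ∷ a ∷ [] =
      transfer-affine pR (transfer-member XOR₃ (s .xor₃) pR) (transfer-member ZERO z)
        (transfer-member ONE o) neg⇒ (transfer-member AND a) ¬maj

    -- The index of a component witnesses that the arity is positive, so nullary functions never
    -- arise.
    inhabited : {g : Fn n} → Fin n → (∀ {m} {g : Fn (suc m)} → Pol R g → Pol S g) → Pol R g → Pol S g
    inhabited zero    t = t
    inhabited (suc _) t = t

    transfer : Dec (Pol R ⟦ XOR₃ ⟧) → Dec (Pol R ⟦ MAJ ⟧) → ∀ j → Pol S (component f j)
    transfer (yes x₃) maj? j = inhabited j (transfer⁺ maj? x₃) (p j)
    transfer (no ¬x₃) _    j = transfer-literal neg⇒ (component-literal ¬x₃ f p (Pol? NOT) j) (p j)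

SameTests⇒SamePPol : {R : Rel k} {S : Rel l} → SameTests R S → SamePPol R S
SameTests⇒SamePPol s n f = mk⇔ (SameTests⇒PPol-⊆ s f) (SameTests⇒PPol-⊆ (SameTests-sym s) f)

signature : Rel k → Vec Bool 6
signature R = map (member R) (XOR₃ ∷ NOT ∷ MAJ ∷ ZERO ∷ ONE ∷ AND ∷ [])

-- Erases the four tests that carry no information about bijections when x + y + z is absent.
normalise : Vec Bool 6 → Vec Bool 6
normalise (false ∷ neg ∷ _) = false ∷ neg ∷ false ∷ false ∷ false ∷ false ∷ []
normalise (true ∷ s)        = true ∷ s

normalise-≡ : ∀ r s → normalise r ≡ normalise s →
  lookup r zero ≡ lookup s zero × lookup r (suc zero) ≡ lookup s (suc zero) ×
  (lookup r zero ≡ true → r ≡ s)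
normalise-≡ (false ∷ a ∷ _) (false ∷ b ∷ _) e = refl , cong (λ v → lookup v (suc zero)) e , λ ()
normalise-≡ (false ∷ a ∷ _) (true ∷ s)      e = contradiction (cong (λ v → lookup v zero) e) λ ()
normalise-≡ (true ∷ r)      (false ∷ b ∷ _) e = contradiction (cong (λ v → lookup v zero) e) λ ()
normalise-≡ (true ∷ r)      (true ∷ s)      e = refl , cong (λ v → lookup v (suc zero)) e , λ _ → e

normalise⇒SameTests : {R : Rel k} {S : Rel l} →
                      normalise (signature R) ≡ normalise (signature S) → SameTests R S
normalise⇒SameTests {R = R} {S} e .xor₃ = proj₁ (normalise-≡ (signature R) (signature S) e)
normalise⇒SameTests {R = R} {S} e .neg  = proj₁ (proj₂ (normalise-≡ (signature R) (signature S) e))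
normalise⇒SameTests {R = R} {S} e .rest x₃ =
  at (suc (suc zero)) ∷ at (suc (suc (suc zero))) ∷ at (suc (suc (suc (suc zero)))) ∷
  at (suc (suc (suc (suc (suc zero))))) ∷ []
  where
  at : ∀ i → lookup (signature R) i ≡ lookup (signature S) i
  at i = cong (λ v → lookup v i) (proj₂ (proj₂ (normalise-≡ (signature R) (signature S) e)) x₃)

-- Given x + y + z: any two of 0, 1, ¬ yield the third, maj with a constant yields ∧, ∧ yields maj
-- as xy + xz + yz, and x ∧ ¬x = 0.
consistent : Vec Bool 6 → Bool
consistent (x₃ ∷ n ∷ m ∷ z ∷ o ∷ a ∷ []) =
  x₃ ⇒ (z ⇒ o ⇒ n) ∧ (z ⇒ n ⇒ o) ∧ (o ⇒ n ⇒ z) ∧ (m ⇒ z ⇒ a) ∧ (m ⇒ o ⇒ a) ∧ (a ⇒ m) ∧ (a ⇒ n ⇒ z)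

signature-consistent : (R : Rel k) → consistent (signature R) ≡ true
signature-consistent R =
  ⇒-intro λ x₃ → cong₂ _∧_ (⇒-intro λ z → ⇒-intro λ o →
      gen (XOR₃ ∷ ZERO ∷ ONE ∷ []) NOT (g₀ 𝕩 (g₁ 𝕩 𝕩 𝕩) (g₂ 𝕩 𝕩 𝕩)) refl (x₃ ∷ z ∷ o ∷ []))
  (cong₂ _∧_ (⇒-intro λ z → ⇒-intro λ n →
      gen (ZERO ∷ NOT ∷ []) ONE (g₁ (g₀ 𝕩 𝕩 𝕩) 𝕩 𝕩) refl (z ∷ n ∷ []))
  (cong₂ _∧_ (⇒-intro λ o → ⇒-intro λ n →
      gen (ONE ∷ NOT ∷ []) ZERO (g₁ (g₀ 𝕩 𝕩 𝕩) 𝕩 𝕩) refl (o ∷ n ∷ []))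
  (cong₂ _∧_ (⇒-intro λ m → ⇒-intro λ z →
      gen (MAJ ∷ ZERO ∷ []) AND (g₀ 𝕩 𝕪 (g₁ 𝕩 𝕩 𝕩)) refl (m ∷ z ∷ []))
  (cong₂ _∧_ (⇒-intro λ m → ⇒-intro λ o →
      gen (XOR₃ ∷ MAJ ∷ ONE ∷ []) AND (g₀ 𝕩 𝕪 (g₁ 𝕩 𝕪 (g₂ 𝕩 𝕩 𝕩))) refl (x₃ ∷ m ∷ o ∷ []))
  (cong₂ _∧_ (⇒-intro λ a →
      gen (XOR₃ ∷ AND ∷ []) MAJ (g₀ (g₁ 𝕩 𝕪 𝕩) (g₁ 𝕩 𝕫 𝕩) (g₁ 𝕪 𝕫 𝕩)) refl (x₃ ∷ a ∷ []))
  (⇒-intro λ a → ⇒-intro λ n →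
      gen (AND ∷ NOT ∷ []) ZERO (g₀ 𝕩 (g₁ 𝕩 𝕩 𝕩) 𝕩) refl (a ∷ n ∷ [])))))))
  where
  gen : (G : Vec Table m) (u : Table) (t : Term m) → eval G t ≡ u →
        All (λ g → member R g ≡ true) G → member R u ≡ true
  gen G u t e ms = Pol⇒member u (generate t u e (All.map (λ {g} → member⇒Pol {R = R} g) ms))

-- In Post's notation: all functions, T₀, T₁, T₀ ∩ T₁, D, D ∩ T₀, L, L ∩ T₀, L ∩ T₁, L ∩ D,
-- L ∩ T₀ ∩ T₁, then not-all-equal (negations and wires) and the order (wires only).
relations : Vec (Σ[ k ∈ ℕ ] Rel (suc k)) 13
relations =
    (0 , λ _ → true)
  ∷ (0 , λ { (a ∷ []) → not a })
  ∷ (0 , λ { (a ∷ []) → a })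
  ∷ (1 , λ { (a ∷ b ∷ []) → not a ∧ b })
  ∷ (1 , λ { (a ∷ b ∷ []) → a xor b })
  ∷ (2 , λ { (a ∷ b ∷ c ∷ []) → (a xor b) ∧ c })
  ∷ (3 , λ { (a ∷ b ∷ c ∷ d ∷ []) → not (a xor (b xor (c xor d))) })
  ∷ (2 , λ { (a ∷ b ∷ c ∷ []) → not (a xor (b xor c)) })
  ∷ (2 , λ { (a ∷ b ∷ c ∷ []) → a xor (b xor c) })
  ∷ (3 , λ { (a ∷ b ∷ c ∷ d ∷ []) → a xor (b xor (c xor d)) })
  ∷ (3 , λ { (a ∷ b ∷ c ∷ d ∷ []) → not (a xor (b xor c)) ∧ d })
  ∷ (2 , λ { (a ∷ b ∷ c ∷ []) → (a xor b) ∨ (b xor c) })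
  ∷ (1 , λ { (a ∷ b ∷ []) → not a ∨ b })
  ∷ []

arity : Fin 13 → ℕ
arity i = suc (proj₁ (lookup relations i))

relation : ∀ i → Rel (arity i)
relation i = proj₂ (lookup relations i)

pattern 𝟎 = false
pattern 𝟏 = true

-- The columns are x + y + z, ¬, maj, 0, 1, ∧.
codes : Vec (Vec Bool 6) 13
codes =
    (𝟏 ∷ 𝟏 ∷ 𝟏 ∷ 𝟏 ∷ 𝟏 ∷ 𝟏 ∷ [])
  ∷ (𝟏 ∷ 𝟎 ∷ 𝟏 ∷ 𝟏 ∷ 𝟎 ∷ 𝟏 ∷ [])
  ∷ (𝟏 ∷ 𝟎 ∷ 𝟏 ∷ 𝟎 ∷ 𝟏 ∷ 𝟏 ∷ [])
  ∷ (𝟏 ∷ 𝟎 ∷ 𝟏 ∷ 𝟎 ∷ 𝟎 ∷ 𝟏 ∷ [])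
  ∷ (𝟏 ∷ 𝟏 ∷ 𝟏 ∷ 𝟎 ∷ 𝟎 ∷ 𝟎 ∷ [])
  ∷ (𝟏 ∷ 𝟎 ∷ 𝟏 ∷ 𝟎 ∷ 𝟎 ∷ 𝟎 ∷ [])
  ∷ (𝟏 ∷ 𝟏 ∷ 𝟎 ∷ 𝟏 ∷ 𝟏 ∷ 𝟎 ∷ [])
  ∷ (𝟏 ∷ 𝟎 ∷ 𝟎 ∷ 𝟏 ∷ 𝟎 ∷ 𝟎 ∷ [])
  ∷ (𝟏 ∷ 𝟎 ∷ 𝟎 ∷ 𝟎 ∷ 𝟏 ∷ 𝟎 ∷ [])
  ∷ (𝟏 ∷ 𝟏 ∷ 𝟎 ∷ 𝟎 ∷ 𝟎 ∷ 𝟎 ∷ [])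
  ∷ (𝟏 ∷ 𝟎 ∷ 𝟎 ∷ 𝟎 ∷ 𝟎 ∷ 𝟎 ∷ [])
  ∷ (𝟎 ∷ 𝟏 ∷ 𝟎 ∷ 𝟎 ∷ 𝟎 ∷ 𝟎 ∷ [])
  ∷ (𝟎 ∷ 𝟎 ∷ 𝟎 ∷ 𝟎 ∷ 𝟎 ∷ 𝟎 ∷ [])
  ∷ []

relation-code : ∀ i → normalise (signature (relation i)) ≡ lookup codes i
relation-code = from-yes (all? λ i → ≡-dec _≟ᵇ_ (normalise (signature (relation i))) (lookup codes i))

-- The last index if v does not occur.
position : Vec Bool m → Vec (Vec Bool m) (suc n) → Fin (suc n)
position v (w ∷ [])        = zero
position v (w ∷ ws@(_ ∷ _)) = if v == w then zero else suc (position v ws)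

class : Rel k → Fin 13
class R = position (normalise (signature R)) codes

-- All 64 vectors are checked: each consistent one normalises to a listed code. The comparison also
-- guards against the default value of `position`.
class-code : (R : Rel k) → normalise (signature R) ≡ lookup codes (class R)
class-code R = ==⇒≡ (normalise (signature R)) (lookup codes (class R)) (⇒-elim
  (every-sound (λ s → consistent s ⇒ (normalise s == lookup codes (position (normalise s) codes)))
    refl (signature R))
  (signature-consistent R))

code⇒SamePPol : (R : Rel k) (i : Fin 13) → normalise (signature R) ≡ lookup codes i →
                SamePPol R (relation i)
code⇒SamePPol R i e = SameTests⇒SamePPol
  (normalise⇒SameTests {R = R} {S = relation i} (trans e (sym (relation-code i))))

-- Reversible gates separating the thirteen clones

Gate : Set
Gate = Table × Table × Table

run : Gate → Vec Bool 3 → Vec Bool 3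
run (a , b , c) v = ⟦ a ⟧ v ∷ ⟦ b ⟧ v ∷ ⟦ c ⟧ v ∷ []

-- A self-inverse gate serves as its own inverse when made into a bijection.
Involutive : Gate → Set
Involutive g = every 3 (λ v → run g (run g v) == v) ≡ true

bijection : (g : Gate) → Involutive g → B 3
bijection g inv = mk↔ₛ′ (run g) (run g) involutive involutive
  where
  involutive : ∀ v → run g (run g v) ≡ v
  involutive v = ==⇒≡ _ v (every-sound (λ v → run g (run g v) == v) inv v)

accepts : Rel k → Gate → Bool
accepts R (a , b , c) = member R a ∧ member R b ∧ member R c

module _ {R : Rel k} where

  accepts⇒PPol : ∀ g inv → accepts R g ≡ true → PPol R 3 (bijection g inv)
  accepts⇒PPol g@(a , b , c) inv e = Pol⇒PPol (bijection g inv) λ where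
      zero             → member⇒Pol a (proj₁ (∧-true e))
      (suc zero)       → member⇒Pol b (proj₁ (∧-true (proj₂ (∧-true {member R a} e))))
      (suc (suc zero)) → member⇒Pol c (proj₂ (∧-true {member R b} (proj₂ (∧-true {member R a} e))))

  PPol⇒accepts : ∀ g inv → PPol R 3 (bijection g inv) → accepts R g ≡ true
  PPol⇒accepts g@(a , b , c) inv p =
    cong₂ _∧_ (Pol⇒member a (q zero))
      (cong₂ _∧_ (Pol⇒member b (q (suc zero))) (Pol⇒member c (q (suc (suc zero)))))
    where
    q : ∀ j → Pol R (component (bijection g inv) j)
    q = PPol⇒Pol (bijection g inv) p

-- On the thirteen relations these detect, in order, ¬, 0, 1, x + y + z, maj and ∧. The fifth has
-- maj as its third component; the last is the Fredkin gate, where c = a gives a ∧ b.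
gates : Vec (Σ Gate Involutive) 6
gates =
    gate (λ a b c → not a) second third refl
  ∷ gate (λ a b c → a xor b) second third refl
  ∷ gate (λ a b c → not (a xor b)) second third refl
  ∷ gate (λ a b c → a xor (b xor c)) second third refl
  -- exchanges 001 and 110
  ∷ (let s = λ a b c → not (a xor b) ∧ (a xor c) in
     gate (λ a b c → a xor s a b c) (λ a b c → b xor s a b c) (λ a b c → c xor s a b c) refl)
  ∷ gate (λ a b c → a) (λ a b c → if a then b else c) (λ a b c → if a then c else b) refl
  ∷ []
  where
  second third : Bool → Bool → Bool → Bool
  second a b c = b
  third a b c = c
  gate : ∀ a b c → Involutive (table a , table b , table c) → Σ Gate Involutive
  gate a b c inv = (table a , table b , table c) , inv

profile : Rel k → Vec Bool 6
profile R = map (accepts R ∘ proj₁) gates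

true⇔⇒≡ : ∀ {a b} → (a ≡ true → b ≡ true) → (b ≡ true → a ≡ true) → a ≡ b
true⇔⇒≡ {false} {false} f g = refl
true⇔⇒≡ {false} {true}  f g = g refl
true⇔⇒≡ {true}          f g = sym (f refl)

-- `SamePPol` compares bijections only, which is why clones are told apart by gates and not by
-- single functions.
profile-cong : {R : Rel k} {S : Rel l} → SamePPol R S → profile R ≡ profile S
profile-cong same = map-cong (λ { (g , inv) → true⇔⇒≡
  (PPol⇒accepts g inv ∘ Equivalence.to (same 3 (bijection g inv)) ∘ accepts⇒PPol g inv)
  (PPol⇒accepts g inv ∘ Equivalence.from (same 3 (bijection g inv)) ∘ accepts⇒PPol g inv) }) gates

profiles : Vec (Vec Bool 6) 13
profiles =
    (𝟏 ∷ 𝟏 ∷ 𝟏 ∷ 𝟏 ∷ 𝟏 ∷ 𝟏 ∷ [])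
  ∷ (𝟎 ∷ 𝟏 ∷ 𝟎 ∷ 𝟏 ∷ 𝟏 ∷ 𝟏 ∷ [])
  ∷ (𝟎 ∷ 𝟎 ∷ 𝟏 ∷ 𝟏 ∷ 𝟏 ∷ 𝟏 ∷ [])
  ∷ (𝟎 ∷ 𝟎 ∷ 𝟎 ∷ 𝟏 ∷ 𝟏 ∷ 𝟏 ∷ [])
  ∷ (𝟏 ∷ 𝟎 ∷ 𝟎 ∷ 𝟏 ∷ 𝟏 ∷ 𝟎 ∷ [])
  ∷ (𝟎 ∷ 𝟎 ∷ 𝟎 ∷ 𝟏 ∷ 𝟏 ∷ 𝟎 ∷ [])
  ∷ (𝟏 ∷ 𝟏 ∷ 𝟏 ∷ 𝟏 ∷ 𝟎 ∷ 𝟎 ∷ [])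
  ∷ (𝟎 ∷ 𝟏 ∷ 𝟎 ∷ 𝟏 ∷ 𝟎 ∷ 𝟎 ∷ [])
  ∷ (𝟎 ∷ 𝟎 ∷ 𝟏 ∷ 𝟏 ∷ 𝟎 ∷ 𝟎 ∷ [])
  ∷ (𝟏 ∷ 𝟎 ∷ 𝟎 ∷ 𝟏 ∷ 𝟎 ∷ 𝟎 ∷ [])
  ∷ (𝟎 ∷ 𝟎 ∷ 𝟎 ∷ 𝟏 ∷ 𝟎 ∷ 𝟎 ∷ [])
  ∷ (𝟏 ∷ 𝟎 ∷ 𝟎 ∷ 𝟎 ∷ 𝟎 ∷ 𝟎 ∷ [])
  ∷ (𝟎 ∷ 𝟎 ∷ 𝟎 ∷ 𝟎 ∷ 𝟎 ∷ 𝟎 ∷ [])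
  ∷ []

-- Recovering the index from the profile shows that the profiles are pairwise distinct.
position-profile : ∀ i → position (profile (relation i)) profiles ≡ i
position-profile = from-yes (all? λ i → position (profile (relation i)) profiles ≟ i)

SamePPol⇒≡ : ∀ i j → SamePPol (relation i) (relation j) → i ≡ j
SamePPol⇒≡ i j same = trans (sym (position-profile i))
  (trans (cong (λ v → position v profiles) (profile-cong {R = relation i} {S = relation j} same))
         (position-profile j))

theorem10 : Σ[ ar ∈ (Fin 13 → ℕ) ] Σ[ Rs ∈ ((i : Fin 13) → Rel (ar i)) ]
    ((∀ i → 1 ≤ ar i)
    × (∀ i j → i ≢ j → ¬ SamePPol (Rs i) (Rs j))
    × (∀ (k : ℕ) (R : Rel k) → 1 ≤ k → Σ[ i ∈ Fin 13 ] SamePPol R (Rs i)))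
theorem10 = arity , relation , (λ _ → s≤s z≤n) , (λ i j i≢j same → i≢j (SamePPol⇒≡ i j same)) ,
  λ k R _ → class R , code⇒SamePPol R (class R) (class-code R)
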